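{- Let $k\ge 3$ be an integer and assume that $\mathrm{N}(k')=4k'-5$ for every integer $k'$ with $3\le k'<k$. Then $\mathrm{N}(k)=4k-5$ holds if and only if every nfs-irreducible clause-irreducible unsatisfiable hitting clause-set $F$ with $\delta(F)=k$ satisfies $n(F)\le 4k-5$.
   Context: Variables are positive integers, literals are nonzero integers, the complement of $x$ is $\overline{x}=-x$, and $\mathrm{var}(x)=|x|$. A clause is a finite set of literals with no pair $x,\overline{x}$. A clause-set is a finite set of clauses; $\top$ is the empty clause-set. $n(F)=|\mathrm{var}(F)|$ (number of variables occurring), $c(F)=|F|$, $\delta(F)=c(F)-n(F)$. $F$ is satisfiable if some clause $C$ meets every clause of $F$, otherwise unsatisfiable. $F$ is hitting if any two distinct clauses $C,D\in F$ have some $x\in C$ with $\overline{x}\in D$. $\mathrm{ldeg}_F(x)$ is the number of clauses of $F$ containing $x$; $v\in\mathrm{var}(F)$ is singular if $\min(\mathrm{ldeg}_F(v),\mathrm{ldeg}_F(\overline v))=1$; $F$ is nonsingular if it has no singular variable. $\mathrm{N}(k)\in\mathbb{N}_0\cup\{+\infty\}$ is the supremum of $n(F)$ over nonsingular unsatisfiable hitting clause-sets $F$ with $\delta(F)=k$. A clause-factor is a clause-set $F'\ne\top$ with $\{C\setminus\bigcap F':C\in F'\}$ unsatisfiable; a clause-factor of $F$ is a subset $F'\subseteq F$ that is a clause-factor; it is trivial if $c(F')=1$ or ($F'$ unsatisfiable and $F'=F$). $F$ is clause-irreducible if all its clause-factors are trivial, else clause-reducible. An nfs-pair is $\{E\cup\{x\},E\cup\{\overline{x},y\}\}$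 with $E$ a clause, $\mathrm{var}(x)\ne\mathrm{var}(y)$, $x,\overline x,y,\overline y\notin E$; its nfs-flip is $\{E\cup\{x,\overline y\},E\cup\{y\}\}$. An nfs-flip on $F$ replaces an nfs-pair $P\subseteq F$, neither of whose flip clauses lies in $F$, by its nfs-flip. A clause-irreducible unsatisfiable hitting clause-set is nfs-irreducible if no finite sequence of nfs-flips transforms it into a clause-reducible clause-set. -}

module Defs where

open import Data.Nat as ℕ using (ℕ; _≤_; _<_; _+_)
open import Data.Nat.Base using (_⊓_)
open import Data.Integer as ℤ using (ℤ; -_; ∣_∣)
open import Data.List using (List; []; _∷_; length; filter; map; concat; deduplicate)
open import Data.List.Membership.Propositional using (_∈_; _∉_)
open import Data.List.Membership.DecPropositional ℤ._≟_ using () renaming (_∈?_ to _∈ℤ?_)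
open import Data.List.Relation.Unary.All as All using (All)
open import Data.List.Relation.Unary.AllPairs using (AllPairs)
open import Data.List.Relation.Unary.Unique.Propositional using (Unique)
open import Data.List.Relation.Binary.Sublist.Propositional using (_⊆_)
open import Data.Product using (Σ; ∃; _×_; _,_)
open import Data.Sum using (_⊎_)
open import Function.Bundles using (_⇔_)
open import Relation.Nullary using (¬_; ¬?)
open import Relation.Binary.PropositionalEquality using (_≡_; _≢_)
open import Relation.Binary.Construct.Closure.ReflexiveTransitive using (Star)

-- Literals are nonzero integers; complement is negation; var x = ∣ x ∣.
Lit : Set
Lit = ℤ

-- A clause is represented canonically as a strictly increasing list of
-- literals (so list equality = set equality).
Clause : Set
Clause = List Lit

WfClause : Clause → Set
WfClause C = AllPairs ℤ._<_ C × All (λ x → x ≢ ℤ.0ℤ) C × (∀ x → x ∈ C → - x ∉ C)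

ClauseSet : Set
ClauseSet = List Clause

WfCS : ClauseSet → Set
WfCS F = All WfClause F × Unique F

vars : ClauseSet → List ℕ
vars F = deduplicate ℕ._≟_ (map ∣_∣ (concat F))

nv : ClauseSet → ℕ
nv F = length (vars F)

cc : ClauseSet → ℕ
cc F = length F

HasDeficiency : ClauseSet → ℕ → Set
HasDeficiency F k = cc F ≡ nv F + k

Satisfiable : ClauseSet → Set
Satisfiable F = Σ Clause λ C → WfClause C × All (λ D → ∃ λ x → x ∈ C × x ∈ D) F

Unsat : ClauseSet → Set
Unsat F = ¬ Satisfiable F

Hitting : ClauseSet → Set
Hitting F = ∀ C D → C ∈ F → D ∈ F → C ≢ D → ∃ λ x → x ∈ C × - x ∈ D

ldeg : ClauseSet → Lit → ℕ
ldeg F x = length (filter (λ C → x ∈ℤ? C) F)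

Singular : ClauseSet → ℕ → Set
Singular F v = v ∈ vars F × (ldeg F (ℤ.+ v) ⊓ ldeg F (- (ℤ.+ v))) ≡ 1

Nonsingular : ClauseSet → Set
Nonsingular F = ∀ v → ¬ Singular F v

NSUHIT : ℕ → ClauseSet → Set
NSUHIT k F = WfCS F × Nonsingular F × Unsat F × Hitting F × HasDeficiency F k

NEq : ℕ → ℕ → Set
NEq k m = (∀ F → NSUHIT k F → nv F ≤ m)
        × (∀ b → (∀ F → NSUHIT k F → nv F ≤ b) → m ≤ b)

inAll? : (F' : ClauseSet) → (x : Lit) → _
inAll? F' x = All.all? (λ C → x ∈ℤ? C) F'

core : ClauseSet → ClauseSet
core F' = map (λ C → filter (λ x → ¬? (inAll? F' x)) C) F'

IsClauseFactor : ClauseSet → Set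
IsClauseFactor F' = F' ≢ [] × Unsat (core F')

-- subsets of F are represented as sublists of F
TrivialFactor : ClauseSet → ClauseSet → Set
TrivialFactor F F' = length F' ≡ 1 ⊎ (Unsat F' × F' ≡ F)

ClauseIrreducible : ClauseSet → Set
ClauseIrreducible F = ∀ F' → F' ⊆ F → IsClauseFactor F' → TrivialFactor F F'

ClauseReducible : ClauseSet → Set
ClauseReducible F = Σ ClauseSet λ F' → F' ⊆ F × IsClauseFactor F' × ¬ TrivialFactor F F'

IsExt : Clause → List Lit → Clause → Set
IsExt E L C = WfClause C × (∀ z → z ∈ C ⇔ (z ∈ E ⊎ z ∈ L))

NfsFlip : ClauseSet → ClauseSet → Set
NfsFlip F G =
  Σ Clause λ E → Σ Lit λ x → Σ Lit λ y →
  Σ Clause λ C₁ → Σ Clause λ C₂ → Σ Clause λ D₁ → Σ Clause λ D₂ →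
    WfClause E × x ≢ ℤ.0ℤ × y ≢ ℤ.0ℤ × ∣ x ∣ ≢ ∣ y ∣
  × x ∉ E × - x ∉ E × y ∉ E × - y ∉ E
  × IsExt E (x ∷ []) C₁ × IsExt E (- x ∷ y ∷ []) C₂
  × IsExt E (x ∷ - y ∷ []) D₁ × IsExt E (y ∷ []) D₂
  × C₁ ∈ F × C₂ ∈ F × D₁ ∉ F × D₂ ∉ F
  × WfCS G
  × (∀ C → C ∈ G ⇔ ((C ∈ F × C ≢ C₁ × C ≢ C₂) ⊎ C ≡ D₁ ⊎ C ≡ D₂))

NfsIrreducible : ClauseSet → Set
NfsIrreducible F = ClauseIrreducible F × Unsat F × Hitting F
  × (∀ G → Star NfsFlip F G → ¬ ClauseReducible G)

{-# OPTIONS --safe #-}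

-- An assignment falsifies exactly one clause of an unsatisfiable hitting clause-set (UHIT), so such sets are treated
-- as partitions of the cube; setting a literal x to true yields a UHIT with ldeg(x) fewer clauses.
--
-- (1) Setting literals of degree one to true until none is left gives n(F) ≤ 4δ − 5 + L for every UHIT with at least
-- two clauses, where L is the number of literals of degree one, as soon as N(δ) ≤ 4δ − 5 (for δ = 1 nothing is assumed).
-- For δ = 2 a variable of minimal degree has literals of degree two, and setting one leaves δ = 1 and L ≤ 3; so N(2) ≤ 3.
--
-- (2) A nontrivial clause-factor splits F into UHITs F₀ and F₁ with δ(F₀) + δ(F₁) = δ(F) + 1 − s, s the number of
-- shared variables. If F is nonsingular, their literals of degree one are over shared variables, except for at
-- most one in F₀, so (1) gives n(F) ≤ 4δ(F) − 5 − s.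
--
-- (3) An nfs-flip of E ∪ {x}, E ∪ {x̄, y} keeps n and δ and lowers only the degree of x̄. If it creates a singularity,
-- setting x̄ to true gives a nonsingular UHIT containing E ∪ {y}, E ∪ {ȳ}, and (2) applies with s ≥ 1. Hence a
-- nonsingular F with n(F) > 4k − 5 is nfs-irreducible. Conversely, a singular variable produces a clause-factor.
--
-- (4) The value 4k − 5 is attained by repeatedly joining a fresh copy of the three-variable example of deficiency 2
-- by a new variable.
module Submission where

open import Defs
open import Data.Bool using (Bool; true; false; not; if_then_else_)
open import Data.Bool.Properties using (not-involutive) renaming (_≟_ to _≟ᵇ_)
open import Data.Empty using (⊥)
open import Data.Integer as ℤ using (ℤ; -_; ∣_∣)
import Data.Integer.Properties as ℤₚ
open import Data.List using (List; []; _∷_; _++_; length; filter; map; concat; upTo)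
open import Data.List.Properties using (length-map; length-++; length-upTo; ≡-dec; filter-notAll; ++-cancelʳ; ∷-injectiveʳ)
open import Data.Nat as ℕ using (ℕ; zero; suc; _+_; _*_; _∸_; _≤_; _<_; z≤n; s≤s)
import Data.Nat.Properties as ℕₚ
open import Data.Nat.Tactic.RingSolver using (solve-∀)
open import Data.List.Membership.DecPropositional ℤ._≟_ using () renaming (_∈?_ to _∈ℤ?_)
open import Data.List.Membership.DecPropositional ℕ._≟_ using () renaming (_∈?_ to _∈ℕ?_)
open import Data.List.Membership.Propositional using (_∈_; _∉_; find; lose)
open import Data.List.Membership.Propositional.Properties using (∈-filter⁺; ∈-filter⁻; ∈-map⁺; ∈-map⁻; ∈-concat⁺′; ∈-concat⁻′; ∈-deduplicate⁺; ∈-deduplicate⁻; ∈-++⁺ˡ; ∈-++⁺ʳ; ∈-++⁻; ∈-length; ∈-upTo⁺; ∈-upTo⁻)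
open import Data.List.Relation.Binary.Pointwise using (Pointwise-≡⇒≡)
open import Data.List.Relation.Binary.Sublist.Propositional using (_⊆_; []; _∷_; _∷ʳ_) renaming (lookup to ⊆-lookup)
open import Data.List.Relation.Binary.Sublist.Propositional.Properties using (All-resp-⊆; filter-⊆; length-mono-≤; to-≋)
open import Data.List.Relation.Unary.All as All using (All; []; _∷_)
import Data.List.Relation.Unary.All.Properties as Allₚ
open import Data.List.Relation.Unary.AllPairs as AllPairs using (AllPairs; []; _∷_)
import Data.List.Relation.Unary.AllPairs.Properties as AllPairsₚ
open import Data.List.Relation.Unary.Any as Any using (here; there)
open import Data.List.Relation.Unary.Unique.DecPropositional.Properties ℕ._≟_ using (deduplicate-!)
open import Data.List.Relation.Unary.Unique.Propositional using (Unique)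
import Data.List.Relation.Unary.Unique.Propositional.Properties as Uniqueₚ
open import Data.Product using (∃; _×_; _,_; proj₁; proj₂)
open import Data.Sum using (_⊎_; inj₁; inj₂; [_,_]′)
open import Function using (_∘_; id)
open import Function.Bundles using (_⇔_; mk⇔; Equivalence)
open import Relation.Binary.Construct.Closure.ReflexiveTransitive using (Star; ε; _◅_)
open import Relation.Binary.Definitions using (DecidableEquality; tri<; tri≈; tri>)
open import Relation.Binary.PropositionalEquality using (_≡_; _≢_; refl; sym; trans; cong; cong₂; subst; module ≡-Reasoning)
open import Relation.Nullary using (¬_; Dec; yes; no; does; contradiction)
open import Relation.Nullary.Decidable using (¬?; _×-dec_; _⊎-dec_; dec-true; dec-false)
open import Relation.Unary using (Decidable)

-- Lists without repetition

∉⇒unique-∷ : ∀ {A : Set} {x : A} {xs} → x ∉ xs → Unique xs → Unique (x ∷ xs)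
∉⇒unique-∷ x∉xs xs! = All.tabulate (λ z∈xs x≡z → x∉xs (subst (_∈ _) (sym x≡z) z∈xs)) ∷ xs!

unique-map : ∀ {A B : Set} (f : A → B) {xs : List A} → Unique xs →
  (∀ {y z} → y ∈ xs → z ∈ xs → f y ≡ f z → y ≡ z) → Unique (map f xs)
unique-map f []            inj = []
unique-map f (x∉xs ∷ xs!) inj = ∉⇒unique-∷
  (λ fx∈ → let z , z∈xs , e = ∈-map⁻ f fx∈ in All.lookup x∉xs z∈xs (inj (here refl) (there z∈xs) e))
  (unique-map f xs! λ p q → inj (there p) (there q))

module _ {A : Set} where

  private
    delete : ∀ {x : A} {ys} → x ∈ ys → List A
    delete {ys = _ ∷ ys} (here _)  = ys
    delete {ys = y ∷ _}  (there p) = y ∷ delete p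

    length-delete : ∀ {x : A} {ys} (p : x ∈ ys) → length ys ≡ suc (length (delete p))
    length-delete (here _)  = refl
    length-delete (there p) = cong suc (length-delete p)

    ∈-delete : ∀ {x z : A} {ys} (p : x ∈ ys) → z ∈ ys → z ≢ x → z ∈ delete p
    ∈-delete (here refl) (here z≡x) z≢x = contradiction z≡x z≢x
    ∈-delete (here _)    (there q)  z≢x = q
    ∈-delete (there _)   (here e)   z≢x = here e
    ∈-delete (there p)   (there q)  z≢x = there (∈-delete p q z≢x)

  unique-⊆⇒length≤ : ∀ {xs ys : List A} → Unique xs → (∀ {z} → z ∈ xs → z ∈ ys) → length xs ≤ length ys
  unique-⊆⇒length≤ []             xs⊆ys = z≤n
  unique-⊆⇒length≤ {x ∷ xs} {ys} (x∉xs ∷ xs!) xs⊆ys = begin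
    suc (length xs)           ≤⟨ s≤s (unique-⊆⇒length≤ xs! λ z∈xs →
                                   ∈-delete x∈ys (xs⊆ys (there z∈xs)) (All.lookup x∉xs z∈xs ∘ sym)) ⟩
    suc (length (delete x∈ys)) ≡⟨ length-delete x∈ys ⟨
    length ys                 ∎
    where
    open ℕₚ.≤-Reasoning
    x∈ys = xs⊆ys (here refl)

  unique-≐⇒length≡ : ∀ {xs ys : List A} → Unique xs → Unique ys →
    (∀ {z} → z ∈ xs → z ∈ ys) → (∀ {z} → z ∈ ys → z ∈ xs) → length xs ≡ length ys
  unique-≐⇒length≡ xs! ys! xs⊆ys ys⊆xs =
    ℕₚ.≤-antisym (unique-⊆⇒length≤ xs! xs⊆ys) (unique-⊆⇒length≤ ys! ys⊆xs)

  length-filter-¬ : ∀ {P : A → Set} (P? : Decidable P) xs →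
    length (filter (¬? ∘ P?) xs) + length (filter P? xs) ≡ length xs
  length-filter-¬ P? []       = refl
  length-filter-¬ P? (x ∷ xs) with P? x
  ... | yes _ = trans (ℕₚ.+-suc _ _) (cong suc (length-filter-¬ P? xs))
  ... | no  _ = cong suc (length-filter-¬ P? xs)

  length≥2 : ∀ {x y : A} {xs} → x ∈ xs → y ∈ xs → x ≢ y → 2 ≤ length xs
  length≥2 {x} {y} x∈ y∈ x≢y = unique-⊆⇒length≤ {xs = x ∷ y ∷ []} ((x≢y ∷ []) ∷ [] ∷ [])
    λ where (here refl) → x∈
            (there (here refl)) → y∈

  length>0⇒∃∈ : ∀ {xs : List A} → 0 < length xs → ∃ (_∈ xs)
  length>0⇒∃∈ {x ∷ _} _ = x , here refl

  minimal∈ : (f : A → ℕ) {x : A} {xs : List A} → x ∈ xs → ∃ λ m → m ∈ xs × (∀ {y} → y ∈ xs → f m ≤ f y)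
  minimal∈ f {xs = x ∷ []} _ = x , here refl , λ where (here refl) → ℕₚ.≤-refl
  minimal∈ f {xs = x ∷ x′ ∷ xs} _ with minimal∈ f {xs = x′ ∷ xs} (here refl)
  ... | m , m∈ , m≤ with ℕₚ.≤-total (f x) (f m)
  ... | inj₁ x≤m = x , here refl , λ where
          (here refl) → ℕₚ.≤-refl
          (there y∈)  → ℕₚ.≤-trans x≤m (m≤ y∈)
  ... | inj₂ m≤x = m , there m∈ , λ where
          (here refl) → m≤x
          (there y∈)  → m≤ y∈

-- Assignments

_≟ᶜ_ : DecidableEquality Clause
_≟ᶜ_ = ≡-dec ℤ._≟_

open import Data.List.Membership.DecPropositional _≟ᶜ_ using () renaming (_∈?_ to _∈ᶜ?_)

Consistent : Clause → Set
Consistent C = ∀ x → x ∈ C → - x ∉ C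

-- The literal `0` is its own complement, so the negation rules below carry `x ≢ ℤ.0ℤ`; for members
-- of a clause, consistency supplies it.
value : (ℕ → Bool) → Lit → Bool
value φ (ℤ.+ v)    = φ v
value φ ℤ.-[1+ v ] = not (φ (suc v))

Falsifies : (ℕ → Bool) → Clause → Set
Falsifies φ C = ∀ x → x ∈ C → value φ x ≡ false

value-neg : ∀ φ {x} → x ≢ ℤ.0ℤ → value φ (- x) ≡ not (value φ x)
value-neg φ {ℤ.+0}       x≢0 = contradiction refl x≢0
value-neg φ {ℤ.+[1+ _ ]} _   = refl
value-neg φ {ℤ.-[1+ _ ]} _   = sym (not-involutive _)

value-neg-true : ∀ φ {x} → x ≢ ℤ.0ℤ → value φ (- x) ≡ false → value φ x ≡ true
value-neg-true φ {x} x≢0 e with value φ x | value-neg φ x≢0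
... | true  | _  = refl
... | false | e′ = contradiction (trans (sym e) e′) λ ()

consistent⇒≢0 : ∀ {C} → Consistent C → ∀ {x} → x ∈ C → x ≢ ℤ.0ℤ
consistent⇒≢0 con x∈C refl = con _ x∈C x∈C

falsifying : Clause → (ℕ → Bool) → ℕ → Bool
falsifying C φ v = if does (ℤ.+ v ∈ℤ? C) then false else if does (- (ℤ.+ v) ∈ℤ? C) then true else φ v

falsifying-∈ : ∀ {C} φ → Consistent C → Falsifies (falsifying C φ) C
falsifying-∈ {C} φ con (ℤ.+ v) x∈C rewrite dec-true (ℤ.+ v ∈ℤ? C) x∈C = refl
falsifying-∈ {C} φ con ℤ.-[1+ v ] x∈C
  rewrite dec-false (ℤ.+ suc v ∈ℤ? C) (con _ x∈C) | dec-true (ℤ.-[1+ v ] ∈ℤ? C) x∈C = refl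

falsifying-∉ : ∀ {C} φ {x} → x ∉ C → - x ∉ C → value (falsifying C φ) x ≡ value φ x
falsifying-∉ {C} φ {ℤ.+ v} x∉ -x∉
  rewrite dec-false (ℤ.+ v ∈ℤ? C) x∉ | dec-false (- (ℤ.+ v) ∈ℤ? C) -x∉ = refl
falsifying-∉ {C} φ {ℤ.-[1+ v ]} x∉ -x∉
  rewrite dec-false (ℤ.-[1+ v ] ∈ℤ? C) x∉ | dec-false (ℤ.+ suc v ∈ℤ? C) -x∉ = refl

falsifying-keeps : ∀ {C D} φ → Consistent C → Falsifies φ D → (∀ {x} → x ∈ D → - x ∉ C) →
  Falsifies (falsifying C φ) D
falsifying-keeps {C} φ con fD noclash x x∈D with x ∈ℤ? C
... | yes x∈C = falsifying-∈ φ con x x∈C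
... | no  x∉C = trans (falsifying-∉ φ x∉C (noclash x∈D)) (fD x x∈D)

singleton-consistent : ∀ {x} → x ≢ ℤ.0ℤ → Consistent (x ∷ [])
singleton-consistent {ℤ.+0}       x≢0 _ (here refl) _ = x≢0 refl
singleton-consistent {ℤ.+[1+ _ ]} x≢0 _ (here refl) (here ())
singleton-consistent {ℤ.-[1+ _ ]} x≢0 _ (here refl) (here ())

neg≢0 : ∀ {x} → x ≢ ℤ.0ℤ → - x ≢ ℤ.0ℤ
neg≢0 x≢0 -x≡0 = x≢0 (ℤₚ.neg-injective -x≡0)

-- Making `x` true amounts to falsifying the unit clause of `- x`, so the facts on `falsifying`
-- carry over.
_[_≔1] : (ℕ → Bool) → Lit → ℕ → Bool
φ [ x ≔1] = falsifying (- x ∷ []) φ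

module _ {x : Lit} (x≢0 : x ≢ ℤ.0ℤ) (φ : ℕ → Bool) where

  ≔1-neg : value (φ [ x ≔1]) (- x) ≡ false
  ≔1-neg = falsifying-∈ φ (singleton-consistent (neg≢0 x≢0)) _ (here refl)

  ≔1-self : value (φ [ x ≔1]) x ≡ true
  ≔1-self = value-neg-true (φ [ x ≔1]) x≢0 ≔1-neg

  ≔1-other : ∀ {z} → z ≢ x → z ≢ - x → value (φ [ x ≔1]) z ≡ value φ z
  ≔1-other {z} z≢x z≢-x = falsifying-∉ {C = - x ∷ []} φ {z}
    (λ where (here e) → z≢-x e)
    (λ where (here e) → z≢x (ℤₚ.neg-injective e))

  ≔1-keeps : ∀ {C} → Falsifies φ C → x ∉ C → Falsifies (φ [ x ≔1]) C
  ≔1-keeps fC x∉C = falsifying-keeps φ (singleton-consistent (neg≢0 x≢0)) fC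
    λ where z∈C (here e) → x∉C (subst (_∈ _) (ℤₚ.neg-injective e) z∈C)

  ≔1-∌ : ∀ {C} → Falsifies (φ [ x ≔1]) C → x ∉ C
  ≔1-∌ fC x∈C = contradiction (trans (sym ≔1-self) (fC _ x∈C)) λ ()

  ≔1-back : ∀ {C} → Falsifies (φ [ x ≔1]) C → - x ∉ C → Falsifies φ C
  ≔1-back fC -x∉C z z∈C = trans (sym (≔1-other (λ z≡x → ≔1-∌ fC (subst (_∈ _) z≡x z∈C))
                                              (λ z≡-x → -x∉C (subst (_∈ _) z≡-x z∈C)))) (fC z z∈C)

-- If `z ∉ C`, falsify `C` starting from an assignment with `z` true. The variable of `z` is either
-- untouched or set because `- z ∈ C`; in both cases `z` stays true.
implied-literal : ∀ {C z} → Consistent C → z ≢ ℤ.0ℤ → (∀ φ → Falsifies φ C → value φ z ≡ false) → z ∈ C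
implied-literal {C} {z} con z≢0 imp with z ∈ℤ? C
... | yes z∈C = z∈C
... | no  z∉C = contradiction (trans (sym z-true) (imp φ (falsifying-∈ _ con))) λ ()
  where
  φ = falsifying C ((λ _ → false) [ z ≔1])
  z-true : value φ z ≡ true
  z-true with - z ∈ℤ? C
  ... | yes -z∈C = value-neg-true φ z≢0 (falsifying-∈ _ con _ -z∈C)
  ... | no  -z∉C = trans (falsifying-∉ _ z∉C -z∉C) (≔1-self z≢0 _)

falsifies? : ∀ φ C → Dec (Falsifies φ C)
falsifies? φ C with All.all? (λ x → value φ x ≟ᵇ false) C
... | yes p = yes λ x → All.lookup p
... | no ¬p = no λ f → ¬p (All.tabulate (f _))

-- Sorted insertion

insert : Lit → Clause → Clause
insert x [] = x ∷ []
insert x (y ∷ C) with ℤₚ.<-cmp x y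
... | tri< _ _ _ = x ∷ y ∷ C
... | tri≈ _ _ _ = y ∷ C
... | tri> _ _ _ = y ∷ insert x C

∈-insert⁻ : ∀ {z} x C → z ∈ insert x C → z ≡ x ⊎ z ∈ C
∈-insert⁻ x [] (here e) = inj₁ e
∈-insert⁻ x (y ∷ C) z∈ with ℤₚ.<-cmp x y | z∈
... | tri< _ _ _ | here e   = inj₁ e
... | tri< _ _ _ | there p  = inj₂ p
... | tri≈ _ _ _ | p        = inj₂ p
... | tri> _ _ _ | here e   = inj₂ (here e)
... | tri> _ _ _ | there p  = [ inj₁ , inj₂ ∘ there ]′ (∈-insert⁻ x C p)

∈-insert-self : ∀ x C → x ∈ insert x C
∈-insert-self x [] = here refl
∈-insert-self x (y ∷ C) with ℤₚ.<-cmp x y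
... | tri< _ _ _   = here refl
... | tri≈ _ e _   = here e
... | tri> _ _ _   = there (∈-insert-self x C)

∈-insert⁺ : ∀ {z} x C → z ∈ C → z ∈ insert x C
∈-insert⁺ x (y ∷ C) z∈ with ℤₚ.<-cmp x y | z∈
... | tri< _ _ _ | p       = there p
... | tri≈ _ _ _ | p       = p
... | tri> _ _ _ | here e  = here e
... | tri> _ _ _ | there p = there (∈-insert⁺ x C p)

insert-sorted : ∀ x {C} → AllPairs ℤ._<_ C → AllPairs ℤ._<_ (insert x C)
insert-sorted x [] = [] ∷ []
insert-sorted x {y ∷ C} (y<C ∷ C↗) with ℤₚ.<-cmp x y
... | tri< x<y _ _ = (x<y ∷ All.map (ℤₚ.<-trans x<y) y<C) ∷ y<C ∷ C↗
... | tri≈ _ _ _   = y<C ∷ C↗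
... | tri> _ _ y<x = All.tabulate (λ z∈ → [ (λ z≡x → subst (y ℤ.<_) (sym z≡x) y<x) , All.lookup y<C ]′ (∈-insert⁻ x C z∈))
                     ∷ insert-sorted x C↗

sorted : List Lit → Clause
sorted []       = []
sorted (x ∷ xs) = insert x (sorted xs)

sorted-↗ : ∀ xs → AllPairs ℤ._<_ (sorted xs)
sorted-↗ []       = []
sorted-↗ (x ∷ xs) = insert-sorted x (sorted-↗ xs)

∈-sorted⁺ : ∀ {z} xs → z ∈ xs → z ∈ sorted xs
∈-sorted⁺ (x ∷ xs) (here refl) = ∈-insert-self x (sorted xs)
∈-sorted⁺ (x ∷ xs) (there p)   = ∈-insert⁺ x (sorted xs) (∈-sorted⁺ xs p)

∈-sorted⁻ : ∀ {z} xs → z ∈ sorted xs → z ∈ xs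
∈-sorted⁻ (x ∷ xs) z∈ = [ here , there ∘ ∈-sorted⁻ xs ]′ (∈-insert⁻ x (sorted xs) z∈)

-- Unsatisfiable hitting clause-sets, semantically

Covering : ClauseSet → Set
Covering F = ∀ φ → ∃ λ C → C ∈ F × Falsifies φ C

-- An assignment that falsifies no clause would satisfy `F`: its true literals among those
-- occurring, sorted, form a clause that meets every member.
unsat⇒covering : ∀ {F} → All WfClause F → Unsat F → Covering F
unsat⇒covering {F} wf unsat φ with Any.any? (falsifies? φ) F
... | yes p = find p
... | no ¬p = contradiction (C , wfC , All.tabulate meets) unsat
  where
  true? = λ x → value φ x ≟ᵇ true
  C = sorted (filter true? (concat F))
  ∈C⁻ : ∀ {x} → x ∈ C → x ∈ concat F × value φ x ≡ true
  ∈C⁻ x∈C = ∈-filter⁻ true? (∈-sorted⁻ _ x∈C)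
  ≢0 : ∀ {x} → x ∈ C → x ≢ ℤ.0ℤ
  ≢0 x∈C with ∈-concat⁻′ F (proj₁ (∈C⁻ x∈C))
  ... | D , x∈D , D∈F = All.lookup (proj₁ (proj₂ (All.lookup wf D∈F))) x∈D
  wfC : WfClause C
  wfC = sorted-↗ (filter true? (concat F)) , All.tabulate ≢0
      , λ x x∈C -x∈C → contradiction
          (trans (sym (proj₂ (∈C⁻ -x∈C))) (trans (value-neg φ (≢0 x∈C)) (cong not (proj₂ (∈C⁻ x∈C))))) λ ()
  meets : ∀ {D} → D ∈ F → ∃ λ x → x ∈ C × x ∈ D
  meets {D} D∈F with Any.any? true? D
  ... | yes q = let x , x∈D , t = find q in
                x , ∈-sorted⁺ _ (∈-filter⁺ true? (∈-concat⁺′ x∈D D∈F) t) , x∈D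
  ... | no ¬q = contradiction (lose D∈F fD) ¬p
    where
    fD : Falsifies φ D
    fD x x∈D with value φ x in e
    ... | true  = contradiction (lose x∈D e) ¬q
    ... | false = refl

-- A satisfying clause `C` is read as the assignment true exactly on the variables positive in `C`.
-- By consistency all literals of `C` are true there, so no clause that `C` meets is falsified.
covering⇒unsat : ∀ {F} → Covering F → Unsat F
covering⇒unsat {F} cov (C , (_ , _ , con) , meets) with cov φ
  where φ = λ v → does (ℤ.+ v ∈ℤ? C)
... | D , D∈F , fD with All.lookup meets D∈F
... | ℤ.+ v , x∈C , x∈D =
      contradiction (trans (sym (dec-true (ℤ.+ v ∈ℤ? C) x∈C)) (fD _ x∈D)) λ ()
... | ℤ.-[1+ v ] , x∈C , x∈D =
      contradiction (trans (sym (cong not (dec-false (ℤ.+ suc v ∈ℤ? C) (con _ x∈C)))) (fD _ x∈D)) λ ()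

-- `Unsat` becomes covering and `Hitting` becomes disjointness of the sets of falsifying
-- assignments. This form passes to restrictions, cores and flips by following one assignment.
record UHit (F : ClauseSet) : Set where
  field
    wf       : All WfClause F
    unique   : Unique F
    covering : Covering F
    disjoint : ∀ φ {C D} → C ∈ F → D ∈ F → Falsifies φ C → Falsifies φ D → C ≡ D

  consistent : ∀ {C} → C ∈ F → Consistent C
  consistent C∈F = proj₂ (proj₂ (All.lookup wf C∈F))

  ≢0 : ∀ {C x} → C ∈ F → x ∈ C → x ≢ ℤ.0ℤ
  ≢0 C∈F = consistent⇒≢0 (consistent C∈F)

  point : ∀ {C} → C ∈ F → ∃ λ φ → Falsifies φ C
  point {C} C∈F = falsifying C (λ _ → false) , falsifying-∈ _ (consistent C∈F)

uhit : ∀ {F} → WfCS F → Unsat F → Hitting F → UHit F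
uhit (wf , u) unsat hit = record
  { wf = wf ; unique = u ; covering = unsat⇒covering wf unsat ; disjoint = disj }
  where
  disj : ∀ φ {C D} → C ∈ _ → D ∈ _ → Falsifies φ C → Falsifies φ D → C ≡ D
  disj φ {C} {D} C∈F D∈F fC fD with C ≟ᶜ D
  ... | yes e = e
  ... | no ne with hit C D C∈F D∈F ne
  ... | x , x∈C , -x∈D = contradiction
          (trans (sym (fC _ x∈C)) (value-neg-true φ (All.lookup (proj₁ (proj₂ (All.lookup wf C∈F))) x∈C) (fD _ -x∈D))) λ ()

clash-free⇒common : ∀ {C D} → Consistent C → Consistent D → (∀ {x} → x ∈ C → - x ∉ D) →
  ∃ λ φ → Falsifies φ C × Falsifies φ D
clash-free⇒common {C} {D} cC cD noclash =
  falsifying D (falsifying C (λ _ → false)) , falsifying-keeps _ cD (falsifying-∈ _ cC) noclash , falsifying-∈ _ cD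

clash? : ∀ C D → Dec (∃ λ x → x ∈ C × - x ∈ D)
clash? C D with Any.any? (λ x → - x ∈ℤ? D) C
... | yes p = let x , x∈C , q = find p in yes (x , x∈C , q)
... | no ¬p = no λ where (x , x∈C , q) → ¬p (lose x∈C q)

uhit-hitting : ∀ {F} → UHit F → Hitting F
uhit-hitting U C D C∈F D∈F C≢D with clash? C D
... | yes p = p
... | no ¬p = let φ , fC , fD = clash-free⇒common (consistent C∈F) (consistent D∈F) (λ x∈C q → ¬p (_ , x∈C , q))
              in contradiction (disjoint φ C∈F D∈F fC fD) C≢D
  where open UHit U

-- Variables and literal degrees

∈-vars⁺ : ∀ {F C x} → C ∈ F → x ∈ C → ∣ x ∣ ∈ vars F
∈-vars⁺ C∈F x∈C = ∈-deduplicate⁺ ℕ._≟_ (∈-map⁺ ∣_∣ (∈-concat⁺′ x∈C C∈F))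

∈-vars⁻ : ∀ F {v} → v ∈ vars F → ∃ λ C → ∃ λ x → C ∈ F × x ∈ C × v ≡ ∣ x ∣
∈-vars⁻ F v∈ with ∈-map⁻ ∣_∣ (∈-deduplicate⁻ ℕ._≟_ (map ∣_∣ (concat F)) v∈)
... | x , x∈ , e with ∈-concat⁻′ F x∈
... | C , x∈C , C∈F = C , x , C∈F , x∈C , e

vars-unique : ∀ F → Unique (vars F)
vars-unique F = deduplicate-! (map ∣_∣ (concat F))

∣∣-cases : ∀ x y → ∣ x ∣ ≡ ∣ y ∣ → x ≡ y ⊎ x ≡ - y
∣∣-cases (ℤ.+ m)      (ℤ.+ n)      e = inj₁ (cong ℤ.+_ e)
∣∣-cases (ℤ.+ _)      ℤ.-[1+ n ]   e = inj₂ (cong ℤ.+_ e)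
∣∣-cases ℤ.-[1+ m ]   (ℤ.+ suc n)  e = inj₂ (cong ℤ.-[1+_] (ℕₚ.suc-injective e))
∣∣-cases ℤ.-[1+ m ]   ℤ.-[1+ n ]   e = inj₁ (cong ℤ.-[1+_] (ℕₚ.suc-injective e))

-- Degree one with the clause kept as data, since the arguments pass to that clause and back.
Once : ClauseSet → Lit → Set
Once F x = ∃ λ C → C ∈ F × x ∈ C × (∀ D → D ∈ F → x ∈ D → D ≡ C)

module _ {F : ClauseSet} {x : Lit} where

  private
    x? : Decidable (x ∈_)
    x? C = x ∈ℤ? C

  once⇒ldeg≡1 : Unique F → Once F x → ldeg F x ≡ 1
  once⇒ldeg≡1 F! (C , C∈F , x∈C , only) = ℕₚ.≤-antisym
    (unique-⊆⇒length≤ {ys = C ∷ []} (Uniqueₚ.filter⁺ x? F!)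
      λ D∈ → let D∈F , x∈D = ∈-filter⁻ x? D∈ in here (only _ D∈F x∈D))
    (∈-length (∈-filter⁺ x? C∈F x∈C))

  ldeg≡1⇒once : ldeg F x ≡ 1 → Once F x
  ldeg≡1⇒once e = go (filter x? F) refl e
    where
    go : ∀ G → filter x? F ≡ G → length G ≡ 1 → Once F x
    go (C ∷ []) eq _ = C , proj₁ C∈ , proj₂ C∈ , only
      where
      C∈ = ∈-filter⁻ x? (subst (C ∈_) (sym eq) (here refl))
      only : ∀ D → D ∈ F → x ∈ D → D ≡ C
      only D D∈F x∈D with subst (_ ∈_) eq (∈-filter⁺ x? D∈F x∈D)
      ... | here e = e

  once? : Unique F → Dec (Once F x)
  once? F! with ldeg F x ℕ.≟ 1
  ... | yes e = yes (ldeg≡1⇒once e)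
  ... | no ne = no (ne ∘ once⇒ldeg≡1 F!)

  ldeg≥1 : ∀ {C} → C ∈ F → x ∈ C → 1 ≤ ldeg F x
  ldeg≥1 C∈F x∈C = ∈-length (∈-filter⁺ x? C∈F x∈C)

  another : ¬ Once F x → ∀ {C} → C ∈ F → x ∈ C → ∃ λ D → D ∈ F × x ∈ D × D ≢ C
  another ¬once {C} C∈F x∈C with Any.any? (λ D → x? D ×-dec ¬? (D ≟ᶜ C)) F
  ... | yes p = let D , D∈F , x∈D , ne = find p in D , D∈F , x∈D , ne
  ... | no ¬p = contradiction (C , C∈F , x∈C , only) ¬once
    where
    only : ∀ D → D ∈ F → x ∈ D → D ≡ C
    only D D∈F x∈D with D ≟ᶜ C
    ... | yes e = e
    ... | no ne = contradiction (lose D∈F (x∈D , ne)) ¬p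

-- Flipping a variable

module _ {F : ClauseSet} (U : UHit F) where
  open UHit U

  -- A clause falsified after the change and free of `- x` would be falsified before it too, hence
  -- would be `C`; but `C` contains `x`, which is now true.
  flip : ∀ {C x φ} → C ∈ F → x ∈ C → Falsifies φ C → ∃ λ D → D ∈ F × - x ∈ D × Falsifies (φ [ x ≔1]) D
  flip {C} {x} {φ} C∈F x∈C fC with covering (φ [ x ≔1])
  ... | D , D∈F , fD with - x ∈ℤ? D
  ... | yes -x∈D = D , D∈F , -x∈D , fD
  ... | no  -x∉D = contradiction (subst (x ∈_) C≡D x∈C) (≔1-∌ x≢0 φ fD)
    where
    x≢0 = ≢0 C∈F x∈C
    C≡D = disjoint φ C∈F D∈F fC (≔1-back x≢0 φ fD -x∉D)

  occurs-neg : ∀ {C x} → C ∈ F → x ∈ C → ∃ λ D → D ∈ F × - x ∈ D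
  occurs-neg C∈F x∈C = let φ , fC = point C∈F
                           D , D∈F , -x∈D , _ = flip C∈F x∈C fC in D , D∈F , -x∈D

  -- Flipping the variable of `x` at an assignment falsifying `D` can only lead into `C`. So the
  -- other literals of `C` are false wherever `D` is falsified, and `implied-literal` puts them into
  -- `D`.
  only-clause-⊆ : ∀ {x C D} → C ∈ F → x ∈ C → (∀ D → D ∈ F → x ∈ D → D ≡ C) →
    D ∈ F → - x ∈ D → ∀ {z} → z ∈ C → z ≢ x → z ∈ D
  only-clause-⊆ {x} {C} {D} C∈F x∈C only D∈F -x∈D {z} z∈C z≢x =
    implied-literal (consistent D∈F) (≢0 C∈F z∈C) imp
    where
    imp : ∀ φ → Falsifies φ D → value φ z ≡ false
    imp φ fD with flip D∈F -x∈D fD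
    ... | C′ , C′∈F , x∈C′ , fC′ with only _ C′∈F (subst (_∈ C′) (ℤₚ.neg-involutive x) x∈C′)
    ... | refl = trans (sym (≔1-other (neg≢0 (≢0 C∈F x∈C)) φ
                   (λ z≡-x → consistent C∈F x x∈C (subst (_∈ C) z≡-x z∈C))
                   (λ z≡--x → z≢x (trans z≡--x (ℤₚ.neg-involutive x))))) (fC′ z z∈C)

  -- For `y ≢ x`, a clause with `- x` contains `y` by `only-clause-⊆`, hence is `C`, which would
  -- then contain both `x` and `- x`.
  once-injective : ∀ {x y C} → C ∈ F → x ∈ C → y ∈ C → Once F x → Once F y → x ≡ y
  once-injective {x} {y} {C} C∈F x∈C y∈C (C₁ , _ , _ , onlyx) (C₂ , _ , _ , onlyy) with y ℤ.≟ x
  ... | yes e = sym e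
  ... | no y≢x with occurs-neg C∈F x∈C
  ... | D , D∈F , -x∈D = contradiction -x∈D (subst (λ E → - x ∉ E) (sym D≡C) (consistent C∈F x x∈C))
    where
    y∈D = only-clause-⊆ C∈F x∈C (λ _ D∈F x∈D → trans (onlyx _ D∈F x∈D) (sym (onlyx _ C∈F x∈C))) D∈F -x∈D y∈C y≢x
    D≡C = trans (onlyy _ D∈F y∈D) (sym (onlyy _ C∈F y∈C))

-- Setting a literal to true

wf-filter : ∀ {P : Lit → Set} (P? : Decidable P) {C} → WfClause C → WfClause (filter P? C)
wf-filter P? (C↗ , ≢0 , con) =
    AllPairsₚ.filter⁺ P? C↗ , Allₚ.filter⁺ P? ≢0
  , λ x x∈ -x∈ → con x (proj₁ (∈-filter⁻ P? x∈)) (proj₁ (∈-filter⁻ P? -x∈))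

remove : Lit → Clause → Clause
remove y = filter (λ z → ¬? (z ℤ.≟ y))

∈-remove⁺ : ∀ {y z C} → z ∈ C → z ≢ y → z ∈ remove y C
∈-remove⁺ {y} = ∈-filter⁺ (λ z → ¬? (z ℤ.≟ y))

∈-remove⁻ : ∀ {y z} C → z ∈ remove y C → z ∈ C × z ≢ y
∈-remove⁻ {y} C = ∈-filter⁻ (λ z → ¬? (z ℤ.≟ y)) {xs = C}

restrict : ClauseSet → Lit → ClauseSet
restrict F x = map (remove (- x)) (filter (λ C → ¬? (x ∈ℤ? C)) F)

∈-restrict⁺ : ∀ {F C x} → C ∈ F → x ∉ C → remove (- x) C ∈ restrict F x
∈-restrict⁺ {x = x} C∈F x∉C = ∈-map⁺ (remove (- x)) (∈-filter⁺ (λ C → ¬? (x ∈ℤ? C)) C∈F x∉C)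

∈-restrict⁻ : ∀ {F D x} → D ∈ restrict F x → ∃ λ C → C ∈ F × x ∉ C × D ≡ remove (- x) C
∈-restrict⁻ {x = x} D∈ with ∈-map⁻ (remove (- x)) D∈
... | C , C∈ , e = let C∈F , x∉C = ∈-filter⁻ (λ C → ¬? (x ∈ℤ? C)) C∈ in C , C∈F , x∉C , e

restrict-∌ : ∀ {F D x z} → D ∈ restrict F x → z ∈ D → z ≢ x × z ≢ - x
restrict-∌ {F} D∈ z∈D with ∈-restrict⁻ {F} D∈
... | C , _ , x∉C , refl = let z∈C , z≢-x = ∈-remove⁻ C z∈D in
      (λ z≡x → x∉C (subst (_∈ C) z≡x z∈C)) , z≢-x

cc-restrict : ∀ F x → cc (restrict F x) + ldeg F x ≡ cc F
cc-restrict F x = trans (cong (_+ ldeg F x) (length-map (remove (- x)) (filter (λ C → ¬? (x ∈ℤ? C)) F)))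
                        (length-filter-¬ (λ C → x ∈ℤ? C) F)

module _ {x : Lit} (x≢0 : x ≢ ℤ.0ℤ) where

  falsifies-remove⁻ : ∀ {φ C} → x ∉ C → Falsifies φ (remove (- x) C) → Falsifies (φ [ x ≔1]) C
  falsifies-remove⁻ {φ} {C} x∉C f z z∈C with z ℤ.≟ - x
  ... | yes refl  = ≔1-neg x≢0 φ
  ... | no  z≢-x = trans (≔1-other x≢0 φ (λ z≡x → x∉C (subst (_∈ C) z≡x z∈C)) z≢-x) (f z (∈-remove⁺ z∈C z≢-x))

  falsifies-remove⁺ : ∀ {φ C} → Falsifies (φ [ x ≔1]) C → Falsifies φ (remove (- x) C)
  falsifies-remove⁺ {φ} {C} fC z z∈ with ∈-remove⁻ C z∈
  ... | z∈C , z≢-x = trans (sym (≔1-other x≢0 φ (λ z≡x → ≔1-∌ x≢0 φ fC (subst (_∈ C) z≡x z∈C)) z≢-x)) (fC z z∈C)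

  module _ {F : ClauseSet} (U : UHit F) where
    open UHit U

    -- Setting a literal to true merges no clauses: an assignment falsifying the common remainder,
    -- with `x` made true, falsifies both originals.
    remove-injective : ∀ {C D} → C ∈ F → D ∈ F → x ∉ C → x ∉ D → remove (- x) C ≡ remove (- x) D → C ≡ D
    remove-injective {C} {D} C∈F D∈F x∉C x∉D e =
      disjoint (φ [ x ≔1]) C∈F D∈F (falsifies-remove⁻ x∉C f) (falsifies-remove⁻ x∉D (subst (Falsifies φ) e f))
      where
      φ = falsifying C (λ _ → false)
      f : Falsifies φ (remove (- x) C)
      f z z∈ = falsifying-∈ _ (consistent C∈F) z (proj₁ (∈-remove⁻ C z∈))

    restrict-uhit : UHit (restrict F x)
    restrict-uhit = record { wf = wf′ ; unique = unique′ ; covering = cov ; disjoint = disj }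
      where
      wf′ : All WfClause (restrict F x)
      wf′ = All.tabulate λ D∈ → let C , C∈F , _ , e = ∈-restrict⁻ {F} D∈ in
              subst WfClause (sym e) (wf-filter _ (All.lookup wf C∈F))
      unique′ : Unique (restrict F x)
      unique′ = unique-map (remove (- x)) (Uniqueₚ.filter⁺ (λ C → ¬? (x ∈ℤ? C)) unique) λ C∈ D∈ →
        let C∈F , x∉C = ∈-filter⁻ (λ C → ¬? (x ∈ℤ? C)) C∈
            D∈F , x∉D = ∈-filter⁻ (λ C → ¬? (x ∈ℤ? C)) D∈
        in remove-injective C∈F D∈F x∉C x∉D
      cov : Covering (restrict F x)
      cov φ = let C , C∈F , fC = covering (φ [ x ≔1]) in
        remove (- x) C , ∈-restrict⁺ C∈F (≔1-∌ x≢0 φ fC) , falsifies-remove⁺ fC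
      disj : ∀ φ {C D} → C ∈ restrict F x → D ∈ restrict F x → Falsifies φ C → Falsifies φ D → C ≡ D
      disj φ C∈ D∈ fC fD with ∈-restrict⁻ {F} C∈ | ∈-restrict⁻ {F} D∈
      ... | C , C∈F , x∉C , refl | D , D∈F , x∉D , refl = cong (remove (- x))
        (disjoint (φ [ x ≔1]) C∈F D∈F (falsifies-remove⁻ x∉C fC) (falsifies-remove⁻ x∉D fD))

-- The condition under which setting `x` to true loses only its own variable. The surviving
-- occurrence `z′` may have the opposite sign.
KeepsVars : ClauseSet → Lit → Set
KeepsVars F x = ∀ {D z} → D ∈ F → z ∈ D → ∣ z ∣ ≢ ∣ x ∣ →
  ∃ λ D′ → ∃ λ z′ → D′ ∈ F × z′ ∈ D′ × ∣ z′ ∣ ≡ ∣ z ∣ × x ∉ D′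

nv-restrict : ∀ {F C x} → C ∈ F → x ∈ C → KeepsVars F x → nv F ≡ suc (nv (restrict F x))
nv-restrict {F} {C} {x} C∈F x∈C keeps =
  unique-≐⇒length≡ (vars-unique F) (∉⇒unique-∷ ∣x∣∉ (vars-unique (restrict F x))) to from
  where
  ∣x∣∉ : ∣ x ∣ ∉ vars (restrict F x)
  ∣x∣∉ v∈ with ∈-vars⁻ (restrict F x) v∈
  ... | D , z , D∈ , z∈D , e = let z≢x , z≢-x = restrict-∌ {F} D∈ z∈D in
        [ z≢x , z≢-x ]′ (∣∣-cases z x (sym e))
  to : ∀ {v} → v ∈ vars F → v ∈ ∣ x ∣ ∷ vars (restrict F x)
  to v∈ with ∈-vars⁻ F v∈
  ... | D , z , D∈F , z∈D , refl with ∣ z ∣ ℕ.≟ ∣ x ∣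
  ... | yes e = here e
  ... | no ne with keeps D∈F z∈D ne
  ... | D′ , z′ , D′∈F , z′∈D′ , e , x∉D′ = there (subst (_∈ vars (restrict F x)) e
        (∈-vars⁺ (∈-restrict⁺ D′∈F x∉D′) (∈-remove⁺ z′∈D′ λ z′≡-x → ne (trans (sym e) (trans (cong ∣_∣ z′≡-x) (ℤₚ.∣-i∣≡∣i∣ x))))))
  from : ∀ {v} → v ∈ ∣ x ∣ ∷ vars (restrict F x) → v ∈ vars F
  from (here refl) = ∈-vars⁺ C∈F x∈C
  from (there v∈) with ∈-vars⁻ (restrict F x) v∈
  ... | D , z , D∈ , z∈D , refl with ∈-restrict⁻ {F} D∈
  ... | E , E∈F , _ , refl = ∈-vars⁺ E∈F (proj₁ (∈-remove⁻ E z∈D))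

-- Deficiency

touches? : ∀ x → Decidable (λ (C : Clause) → x ∈ C ⊎ - x ∈ C)
touches? x C = (x ∈ℤ? C) ⊎-dec (- x ∈ℤ? C)

vdeg : ClauseSet → Lit → ℕ
vdeg F x = length (filter (touches? x) F)

MinDegree : ClauseSet → Lit → Set
MinDegree F x = ∀ {C z} → C ∈ F → z ∈ C → vdeg F x ≤ vdeg F z

module _ {F : ClauseSet} (U : UHit F) where
  open UHit U

  -- If every clause with the variable of `z` contained `x`, a clause with `- x` would be one more
  -- clause with the variable of `x`, so `z` would have smaller variable degree.
  minDegree-keepsVars : ∀ {C x} → C ∈ F → x ∈ C → MinDegree F x → KeepsVars F x
  minDegree-keepsVars {C} {x} C∈F x∈C min {D} {z} D∈F z∈D ne
    with Any.any? (λ D′ → touches? z D′ ×-dec ¬? (x ∈ℤ? D′)) F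
  ... | yes p with find p
  ...   | D′ , D′∈F , inj₁ z∈ , x∉ = D′ , z , D′∈F , z∈ , refl , x∉
  ...   | D′ , D′∈F , inj₂ -z∈ , x∉ = D′ , - z , D′∈F , -z∈ , ℤₚ.∣-i∣≡∣i∣ z , x∉
  minDegree-keepsVars {C} {x} C∈F x∈C min {D} {z} D∈F z∈D ne
      | no ¬p with occurs-neg U C∈F x∈C
  ...   | E , E∈F , -x∈E = contradiction (min D∈F z∈D) (ℕₚ.<⇒≱ smaller)
    where
    x∈touched : ∀ {D′} → D′ ∈ F → z ∈ D′ ⊎ - z ∈ D′ → x ∈ D′
    x∈touched {D′} D′∈F t with x ∈ℤ? D′
    ... | yes x∈ = x∈
    ... | no  x∉ = contradiction (lose D′∈F (t , x∉)) ¬p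
    E∉ : E ∉ filter (touches? z) F
    E∉ E∈ = let _ , t = ∈-filter⁻ (touches? z) {xs = F} E∈ in consistent E∈F x (x∈touched E∈F t) -x∈E
    smaller : vdeg F z < vdeg F x
    smaller = unique-⊆⇒length≤ (∉⇒unique-∷ E∉ (Uniqueₚ.filter⁺ (touches? z) unique)) λ where
      (here refl) → ∈-filter⁺ (touches? x) E∈F (inj₂ -x∈E)
      (there D∈)  → let D∈F , t = ∈-filter⁻ (touches? z) {xs = F} D∈ in
                    ∈-filter⁺ (touches? x) D∈F (inj₁ (x∈touched D∈F t))

  minDegree-exists : 1 ≤ nv F → ∃ λ C → ∃ λ x → C ∈ F × x ∈ C × MinDegree F x
  minDegree-exists n≥1 with length>0⇒∃∈ n≥1
  ... | v , v∈ with ∈-vars⁻ F v∈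
  ... | C , z , C∈F , z∈C , _ with minimal∈ (vdeg F) (∈-concat⁺′ z∈C C∈F)
  ... | x , x∈ , min with ∈-concat⁻′ F x∈
  ... | D , x∈D , D∈F = D , x , D∈F , x∈D , λ E∈F y∈E → min (∈-concat⁺′ y∈E E∈F)

-- Induction on the number of variables: setting a literal of minimal variable degree to true loses
-- exactly one variable and at least one clause.
deficiency≥1 : ∀ {F} → UHit F → nv F < cc F
deficiency≥1 U = go _ U refl
  where
  go : ∀ n {F} → UHit F → nv F ≡ n → nv F < cc F
  go zero {F} U e rewrite e = let _ , C∈F , _ = UHit.covering U (λ _ → false) in ∈-length C∈F
  go (suc n) {F} U e with minDegree-exists U (subst (1 ≤_) (sym e) (s≤s z≤n))
  ... | C , x , C∈F , x∈C , min = begin-strict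
    nv F                              ≡⟨ nvF ⟩
    suc (nv (restrict F x))           <⟨ s≤s (go n (restrict-uhit (UHit.≢0 U C∈F x∈C) U) (ℕₚ.suc-injective (trans (sym nvF) e))) ⟩
    suc (cc (restrict F x))           ≡⟨ ℕₚ.+-comm 1 _ ⟩
    cc (restrict F x) + 1             ≤⟨ ℕₚ.+-monoʳ-≤ _ (ldeg≥1 C∈F x∈C) ⟩
    cc (restrict F x) + ldeg F x      ≡⟨ cc-restrict F x ⟩
    cc F                              ∎
    where
    open ℕₚ.≤-Reasoning
    nvF = nv-restrict C∈F x∈C (minDegree-keepsVars U C∈F x∈C min)

-- The restriction has one variable and `ldeg F x` clauses fewer, and its deficiency is still
-- positive; so `ldeg F x` is at most the deficiency of `F`.
minDegree-ldeg : ∀ {F} → UHit F → ∀ {C x} → C ∈ F → x ∈ C → MinDegree F x → nv F + ldeg F x ≤ cc F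
minDegree-ldeg {F} U {C} {x} C∈F x∈C min = begin
  nv F + ldeg F x                    ≡⟨ cong (_+ ldeg F x) (nv-restrict C∈F x∈C (minDegree-keepsVars U C∈F x∈C min)) ⟩
  suc (nv (restrict F x)) + ldeg F x ≤⟨ ℕₚ.+-monoˡ-≤ _ (deficiency≥1 (restrict-uhit (UHit.≢0 U C∈F x∈C) U)) ⟩
  cc (restrict F x) + ldeg F x       ≡⟨ cc-restrict F x ⟩
  cc F                               ∎
  where open ℕₚ.≤-Reasoning

-- Nonsingularity

NoOnce : ClauseSet → Set
NoOnce F = ∀ x → ¬ Once F x

noOnce⇒nonsingular : ∀ {F} → NoOnce F → Nonsingular F
noOnce⇒nonsingular {F} ns v (_ , e) with ℕₚ.⊓-sel (ldeg F (ℤ.+ v)) (ldeg F (- (ℤ.+ v)))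
... | inj₁ m = ns _ (ldeg≡1⇒once (trans (sym m) e))
... | inj₂ m = ns _ (ldeg≡1⇒once (trans (sym m) e))

nonsingular⇒noOnce : ∀ {F} → UHit F → Nonsingular F → NoOnce F
nonsingular⇒noOnce {F} U ns x once@(C , C∈F , x∈C , _) = ns ∣ x ∣ (∈-vars⁺ C∈F x∈C , min≡1 x deg≡1 deg-neg≥1)
  where
  deg≡1 = once⇒ldeg≡1 (UHit.unique U) once
  -- The minimum is one only if the complement occurs at all.
  deg-neg≥1 : 1 ≤ ldeg F (- x)
  deg-neg≥1 = let D , D∈F , -x∈D = occurs-neg U C∈F x∈C in ldeg≥1 D∈F -x∈D
  min≡1 : ∀ x → ldeg F x ≡ 1 → 1 ≤ ldeg F (- x) → ldeg F (ℤ.+ ∣ x ∣) ℕ.⊓ ldeg F (- (ℤ.+ ∣ x ∣)) ≡ 1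
  min≡1 (ℤ.+ v)    e p = trans (ℕₚ.m≤n⇒m⊓n≡m (ℕₚ.≤-trans (ℕₚ.≤-reflexive e) p)) e
  min≡1 ℤ.-[1+ v ] e p = trans (ℕₚ.m≥n⇒m⊓n≡n (ℕₚ.≤-trans (ℕₚ.≤-reflexive e) p)) e

-- Written additively to keep truncated subtraction out of the induction.
Bound : ℕ → Set
Bound k = ∀ {F} → UHit F → NoOnce F → HasDeficiency F k → nv F + 5 ≤ 4 * k

-- Literals of degree one under restriction

module _ {F : ClauseSet} (U : UHit F) where
  open UHit U

  -- Only the clause `C` of `x` is dropped. If `z ∉ C`, the occurrences of `z` are unchanged. If
  -- `z ∈ C`, then `z` lies in every clause with `- x`; all of these survive, so there is just one.
  once-restrict : ∀ {x z} → Once F x → Once (restrict F x) z →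
    Once F z ⊎ (∃ λ D → z ∈ D × D ∈ F × - x ∈ D × (∀ D′ → D′ ∈ F → - x ∈ D′ → D′ ≡ D))
  once-restrict {x} {z} (C , C∈F , x∈C , onlyC) (E , E∈ , z∈E , onlyE) with ∈-restrict⁻ {F} E∈
  ... | D , D∈F , x∉D , refl = result
    where
    x≢0 = ≢0 C∈F x∈C
    z∈D = proj₁ (∈-remove⁻ D z∈E)
    z≢x = proj₁ (restrict-∌ {F} E∈ z∈E)
    z≢-x = proj₂ (restrict-∌ {F} E∈ z∈E)
    same : ∀ D′ → D′ ∈ F → x ∉ D′ → z ∈ D′ → D′ ≡ D
    same D′ D′∈F x∉D′ z∈D′ = remove-injective x≢0 U D′∈F D∈F x∉D′ x∉D
      (onlyE _ (∈-restrict⁺ D′∈F x∉D′) (∈-remove⁺ z∈D′ z≢-x))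
    result : Once F z ⊎ (∃ λ D → z ∈ D × D ∈ F × - x ∈ D × (∀ D′ → D′ ∈ F → - x ∈ D′ → D′ ≡ D))
    result with z ∈ℤ? C
    ... | no z∉C = inj₁ (D , D∈F , z∈D , λ D′ D′∈F z∈D′ →
            same D′ D′∈F (λ x∈D′ → z∉C (subst (z ∈_) (onlyC D′ D′∈F x∈D′) z∈D′)) z∈D′)
    ... | yes z∈C = inj₂ (D , z∈D , D∈F , -x∈D , same-neg)
      where
      same-neg : ∀ D′ → D′ ∈ F → - x ∈ D′ → D′ ≡ D
      same-neg D′ D′∈F -x∈D′ = same D′ D′∈F (λ x∈D′ → consistent D′∈F x x∈D′ -x∈D′)
        (only-clause-⊆ U C∈F x∈C onlyC D′∈F -x∈D′ z∈C z≢x)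
      -x∈D : - x ∈ D
      -x∈D = let D′ , D′∈F , -x∈D′ = occurs-neg U C∈F x∈C in subst (- x ∈_) (same-neg D′ D′∈F -x∈D′) -x∈D′

  -- A variable met in the clause of `x` also has a clause with the complementary literal; that is a
  -- different clause, so it lacks `x`.
  once-keepsVars : ∀ {x} → Once F x → KeepsVars F x
  once-keepsVars {x} (C , C∈F , x∈C , onlyC) {D} {z} D∈F z∈D _ with x ∈ℤ? D
  ... | no x∉D = D , z , D∈F , z∈D , refl , x∉D
  ... | yes x∈D with occurs-neg U D∈F z∈D
  ... | E , E∈F , -z∈E = E , - z , E∈F , -z∈E , ℤₚ.∣-i∣≡∣i∣ z , λ x∈E →
        consistent D∈F z z∈D (subst (- z ∈_) (trans (onlyC E E∈F x∈E) (sym (onlyC D D∈F x∈D))) -z∈E)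

  once-nv : ∀ {x} → Once F x → nv F ≡ suc (nv (restrict F x))
  once-nv o@(_ , C∈F , x∈C , _) = nv-restrict C∈F x∈C (once-keepsVars o)

  once-cc : ∀ {x} → Once F x → cc F ≡ suc (cc (restrict F x))
  once-cc {x} o = trans (sym (cc-restrict F x)) (trans (cong (cc (restrict F x) +_) (once⇒ldeg≡1 unique o)) (ℕₚ.+-comm _ 1))

length-remove : ∀ {x S} → x ∈ S → length (remove x S) < length S
length-remove {x} {S} x∈S = filter-notAll (λ z → ¬? (z ℤ.≟ x)) S (lose x∈S λ ne → ne refl)

-- The number of degree-one literals enters only through the length of a list containing them, which
-- may also hold others.
CoversOnce : List Lit → ClauseSet → Set
CoversOnce S F = ∀ z → Once F z → z ∈ S

-- At most one new literal of degree one arises, and only when both x and - x have degree one.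
coversOnce-restrict : ∀ {F x S} → UHit F → Once F x → CoversOnce S F →
  ∃ λ S′ → length S′ < length S × CoversOnce S′ (restrict F x)
coversOnce-restrict {F} {x} {S} U once-x cover with once? {F} { - x} (UHit.unique U)
... | no ¬once = remove x S , length-remove (cover x once-x) , cover′
  where
  cover′ : CoversOnce (remove x S) (restrict F x)
  cover′ z once-z@(_ , E∈ , z∈E , _) with once-restrict U once-x once-z
  ... | inj₁ once-z = ∈-remove⁺ (cover z once-z) (proj₁ (restrict-∌ {F} E∈ z∈E))
  ... | inj₂ (D , _ , rest) = contradiction (D , rest) ¬once
... | yes once-nx@(D , D∈F , -x∈D , only) = result
  where
  R = restrict F x
  x≢0 = UHit.≢0 U (proj₁ (proj₂ once-x)) (proj₁ (proj₂ (proj₂ once-x)))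
  UR = restrict-uhit x≢0 U
  S₂ = remove (- x) (remove x S)
  -x∈ : - x ∈ remove x S
  -x∈ = ∈-remove⁺ (cover (- x) once-nx) λ -x≡x →
    UHit.consistent U D∈F (- x) -x∈D (subst (_∈ D) (sym (cong -_ -x≡x)) -x∈D)
  shorter : suc (length S₂) < length S
  shorter = ℕₚ.≤-trans (s≤s (length-remove -x∈)) (length-remove (cover x once-x))
  R∋D : remove (- x) D ∈ R
  R∋D = ∈-restrict⁺ D∈F λ x∈D → UHit.consistent U D∈F x x∈D -x∈D
  split : ∀ z → Once R z → z ∈ S₂ ⊎ z ∈ remove (- x) D
  split z once-z@(_ , E∈ , z∈E , _) with once-restrict U once-x once-z | restrict-∌ {F} E∈ z∈E
  ... | inj₁ once-z | z≢x , z≢-x = inj₁ (∈-remove⁺ (∈-remove⁺ (cover z once-z) z≢x) z≢-x)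
  ... | inj₂ (D′ , z∈D′ , D′∈F , -x∈D′ , _) | z≢x , z≢-x =
        inj₂ (∈-remove⁺ (subst (z ∈_) (only D′ D′∈F -x∈D′) z∈D′) z≢-x)
  result : ∃ λ S′ → length S′ < length S × CoversOnce S′ R
  -- New degree-one literals all lie in the clause left of `D`, where `once-injective` allows at
  -- most one. It takes one of the two places freed by `x` and `- x`.
  result with Any.any? (λ z → once? {R} {z} (UHit.unique UR)) (remove (- x) D)
  ... | no ¬p = S₂ , ℕₚ.<-trans (ℕₚ.n<1+n _) shorter , λ z once-z →
          [ id , (λ z∈ → contradiction (lose z∈ once-z) ¬p) ]′ (split z once-z)
  ... | yes p = let z₀ , z₀∈ , once-z₀ = find p in z₀ ∷ S₂ , shorter , λ z once-z →
          [ there , (λ z∈ → here (once-injective UR R∋D z∈ z₀∈ once-z once-z₀)) ]′ (split z once-z)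

-- Literals of degree one are set to true until none is left; every step removes one variable and one clause,
-- and shortens S.
nv-bound : ∀ {F k} S → UHit F → 2 ≤ cc F → HasDeficiency F k → (2 ≤ k → Bound k) → CoversOnce S F →
  nv F + 5 ≤ 4 * k + length S
nv-bound {k = k} S₀ U₀ two₀ def₀ bound = go _ S₀ U₀ two₀ refl def₀
  where
  open ℕₚ.≤-Reasoning
  go : ∀ n {F} S → UHit F → 2 ≤ cc F → nv F ≡ n → HasDeficiency F k → CoversOnce S F → nv F + 5 ≤ 4 * k + length S
  go n {F} S U two e def cover with Any.any? (λ x → once? {F} {x} (UHit.unique U)) S
  ... | no ¬p = nonsing k def bound
    where
    ns : NoOnce F
    ns x once-x = ¬p (lose (cover x once-x) once-x)
    nonsing : ∀ k → HasDeficiency F k → (2 ≤ k → Bound k) → nv F + 5 ≤ 4 * k + length S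
    nonsing 0 def _ = contradiction (deficiency≥1 U) (ℕₚ.≤⇒≯ (ℕₚ.≤-reflexive (trans def (ℕₚ.+-identityʳ _))))
    -- Two clauses and deficiency one force a variable, and then `minDegree-ldeg` yields a literal
    -- of degree one, contrary to `ns`.
    nonsing 1 def _ with minDegree-exists U (ℕₚ.+-cancelʳ-≤ 1 1 (nv F) (subst (2 ≤_) def two))
    ... | C , x , C∈F , x∈C , min = contradiction (ldeg≡1⇒once (ℕₚ.≤-antisym
            (ℕₚ.+-cancelˡ-≤ (nv F) _ _ (subst (nv F + ldeg F x ≤_) def (minDegree-ldeg U C∈F x∈C min)))
            (ldeg≥1 C∈F x∈C))) (ns x)
    nonsing (suc (suc k)) def bound = ℕₚ.≤-trans (bound (s≤s (s≤s z≤n)) U ns def) (ℕₚ.m≤m+n _ _)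
  ... | yes p with find p
  ... | x , x∈S , once-x@(C , C∈F , x∈C , _) = result n e
    where
    x≢0 = UHit.≢0 U C∈F x∈C
    R = restrict F x
    UR = restrict-uhit x≢0 U
    nvF = once-nv U once-x
    ccF = once-cc U once-x
    defR : HasDeficiency R k
    defR = ℕₚ.suc-injective (trans (sym ccF) (trans def (cong (_+ k) nvF)))
    -- The end of the descent: `F` has two clauses, one variable and deficiency one. Both `x` and
    -- `- x` have degree one, so `S` has two elements and `1 + 5 ≤ 4 + 2` is tight.
    small : ¬ 2 ≤ cc R → nv F + 5 ≤ 4 * k + length S
    small ¬two = begin
      nv F + 5           ≡⟨ cong (_+ 5) nvF≡1 ⟩
      4 + 2              ≤⟨ ℕₚ.+-monoʳ-≤ 4 (length≥2 x∈S -x∈S x≢-x) ⟩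
      4 + length S       ≡⟨ cong (λ k → 4 * k + length S) k≡1 ⟨
      4 * k + length S   ∎
      where
      ccF≡2 : cc F ≡ 2
      ccF≡2 = ℕₚ.≤-antisym (subst (_≤ 2) (sym ccF) (s≤s (ℕₚ.≤-pred (ℕₚ.≰⇒> ¬two)))) two
      nvF≡1 : nv F ≡ 1
      nvF≡1 = ℕₚ.≤-antisym (ℕₚ.≤-pred (subst (nv F <_) ccF≡2 (deficiency≥1 U))) (subst (1 ≤_) (sym nvF) (s≤s z≤n))
      k≡1 : k ≡ 1
      k≡1 = ℕₚ.suc-injective (trans (cong (_+ k) (sym nvF≡1)) (trans (sym def) ccF≡2))
      x≢-x : x ≢ - x
      x≢-x x≡-x = UHit.consistent U C∈F x x∈C (subst (_∈ C) x≡-x x∈C)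
      -x∈S : - x ∈ S
      -x∈S with occurs-neg U C∈F x∈C
      ... | D , D∈F , -x∈D = cover (- x) (D , D∈F , -x∈D , only)
        where
        x∉ : ∀ {D} → D ∈ F → - x ∈ D → x ∉ D
        x∉ D∈F -x∈D x∈D = UHit.consistent U D∈F x x∈D -x∈D
        only : ∀ D′ → D′ ∈ F → - x ∈ D′ → D′ ≡ D
        only D′ D′∈F -x∈D′ with D′ ≟ᶜ D
        ... | yes e = e
        ... | no ne = contradiction (length≥2 (∈-restrict⁺ D′∈F (x∉ D′∈F -x∈D′)) (∈-restrict⁺ D∈F (x∉ D∈F -x∈D))
                (ne ∘ remove-injective x≢0 U D′∈F D∈F (x∉ D′∈F -x∈D′) (x∉ D∈F -x∈D))) ¬two
    result : ∀ n → nv F ≡ n → nv F + 5 ≤ 4 * k + length S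
    result zero    e = contradiction (trans (sym e) nvF) λ ()
    result (suc n) e with 2 ℕ.≤? cc R
    ... | no ¬two = small ¬two
    ... | yes two′ with coversOnce-restrict U once-x cover
    ... | S′ , shorter , cover′ = begin
      nv F + 5                   ≡⟨ cong (_+ 5) nvF ⟩
      suc (nv R + 5)             ≤⟨ s≤s (go n S′ UR two′ (ℕₚ.suc-injective (trans (sym nvF) e)) defR cover′) ⟩
      suc (4 * k + length S′)    ≡⟨ ℕₚ.+-suc (4 * k) (length S′) ⟨
      4 * k + suc (length S′)    ≤⟨ ℕₚ.+-monoʳ-≤ (4 * k) shorter ⟩
      4 * k + length S           ∎

-- Deficiency two

at-most-one : ∀ {A : Set} {P : A → Set} (P? : Decidable P) (xs : List A) →
  (∀ {y z} → y ∈ xs → z ∈ xs → P y → P z → y ≡ z) →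
  ∃ λ S → length S ≤ 1 × (∀ {z} → z ∈ xs → P z → z ∈ S)
at-most-one P? xs inj with Any.any? P? xs
... | yes p = let y , y∈ , py = find p in y ∷ [] , ℕₚ.≤-refl , λ z∈ pz → here (inj z∈ y∈ pz py)
... | no ¬p = [] , z≤n , λ z∈ pz → contradiction (lose z∈ pz) ¬p

module _ {F : ClauseSet} (U : UHit F) where
  open UHit U

  private
    falsifies-remove⁻′ : ∀ {B x φ} → B ∈ F → x ∈ B → Falsifies φ (remove x B) → Falsifies (φ [ - x ≔1]) B
    falsifies-remove⁻′ {B} {x} {φ} B∈F x∈B f = falsifies-remove⁻ (neg≢0 (≢0 B∈F x∈B)) (consistent B∈F x x∈B)
      (subst (λ y → Falsifies φ (remove y B)) (sym (ℤₚ.neg-involutive x)) f)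

  -- By `flip`, the clauses with `x` and the clauses with `- x`, each stripped of that literal,
  -- cover the same assignments.
  cross : ∀ {B x φ} → B ∈ F → x ∈ B → Falsifies φ (remove x B) →
    ∃ λ A → A ∈ F × - x ∈ A × Falsifies φ (remove (- x) A)
  cross {B} {x} {φ} B∈F x∈B f with flip U B∈F x∈B (falsifies-remove⁻′ B∈F x∈B f)
  ... | A , A∈F , -x∈A , fA = A , A∈F , -x∈A , λ y y∈ →
        let y∈A , y≢-x = ∈-remove⁻ A y∈ in
        trans (sym (≔1-other (neg≢0 x≢0) φ y≢-x (λ y≡--x → consistent A∈F x
                (subst (_∈ A) (trans y≡--x (ℤₚ.neg-involutive x)) y∈A) -x∈A)))
              (falsifies-remove⁺ x≢0 {φ [ - x ≔1]} {A} fA y y∈)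
    where x≢0 = ≢0 B∈F x∈B

  cross′ : ∀ {A x φ} → A ∈ F → - x ∈ A → Falsifies φ (remove (- x) A) →
    ∃ λ B → B ∈ F × x ∈ B × Falsifies φ (remove x B)
  cross′ {A} {x} {φ} A∈F -x∈A f = let B , B∈F , x∈B , fB = cross A∈F -x∈A f in
    B , B∈F , subst (_∈ B) (ℤₚ.neg-involutive x) x∈B , subst (λ y → Falsifies φ (remove y B)) (ℤₚ.neg-involutive x) fB

  module TwoClauses {x : Lit} {B₁ B₂ : Clause} (B₁∈F : B₁ ∈ F) (B₂∈F : B₂ ∈ F) (x∈B₁ : x ∈ B₁) (x∈B₂ : x ∈ B₂)
    (B₁≢B₂ : B₁ ≢ B₂) (only : ∀ D → D ∈ F → x ∈ D → D ≡ B₁ ⊎ D ≡ B₂) where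

    Common : Clause → Clause → (ℕ → Bool) → Set
    Common B A φ = Falsifies φ (remove x B) × Falsifies φ (remove (- x) A)

    -- Making `z` true keeps `A` falsified up to `- x`. Crossing back leads to a clause with `x`,
    -- which cannot be `B₁` because `B₁` contains the true literal `z`.
    free-shift : ∀ {A z φ} → A ∈ F → - x ∈ A → Common B₁ A φ → z ∈ B₁ → z ≢ x → z ∉ A → Common B₂ A (φ [ z ≔1])
    free-shift {A} {z} {φ} A∈F -x∈A (f₁ , fA) z∈B₁ z≢x z∉A with cross′ A∈F -x∈A fA′
      where fA′ = ≔1-keeps (≢0 B₁∈F z∈B₁) φ {remove (- x) A} fA (z∉A ∘ proj₁ ∘ ∈-remove⁻ A)
    ... | B , B∈F , x∈B , fB with only B B∈F x∈B
    ... | inj₁ refl = contradiction (∈-remove⁺ z∈B₁ z≢x) (≔1-∌ (≢0 B₁∈F z∈B₁) φ fB)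
    ... | inj₂ refl = fB , ≔1-keeps (≢0 B₁∈F z∈B₁) φ {remove (- x) A} fA (z∉A ∘ proj₁ ∘ ∈-remove⁻ A)

    -- For `y ≢ z`, `free-shift` falsifies `B₂` up to `x` both after making `y` true and after
    -- making `z` true. The first settles every literal of `B₂` under `φ` except `- y`, and the
    -- second settles that one; so `B₁` and `B₂` would overlap.
    free-unique : ∀ {A y z φ} → A ∈ F → - x ∈ A → Common B₁ A φ →
      y ∈ B₁ → z ∈ B₁ → y ≢ x × y ∉ A → z ≢ x × z ∉ A → y ≡ z
    free-unique {A} {y} {z} {φ} A∈F -x∈A com@(f₁ , fA) y∈B₁ z∈B₁ (y≢x , y∉A) (z≢x , z∉A) with y ℤ.≟ z
    ... | yes e = e
    ... | no y≢z = contradiction (disjoint (φ [ - x ≔1]) B₁∈F B₂∈F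
                     (falsifies-remove⁻′ B₁∈F x∈B₁ f₁) (falsifies-remove⁻′ B₂∈F x∈B₂ f₂)) B₁≢B₂
      where
      y≢0 = ≢0 B₁∈F y∈B₁
      z≢0 = ≢0 B₁∈F z∈B₁
      fy = proj₁ (free-shift A∈F -x∈A com y∈B₁ y≢x y∉A)
      fz = proj₁ (free-shift A∈F -x∈A com z∈B₁ z≢x z∉A)
      f₂ : Falsifies φ (remove x B₂)
      f₂ w w∈ with w ℤ.≟ - y
      ... | no w≢-y = trans (sym (≔1-other y≢0 φ (λ w≡y → ≔1-∌ y≢0 φ fy (subst (_∈ _) w≡y w∈)) w≢-y)) (fy w w∈)
      ... | yes refl = trans (sym (≔1-other z≢0 φ
                (λ -y≡z → ≔1-∌ z≢0 φ fz (subst (_∈ _) -y≡z w∈)) (y≢z ∘ ℤₚ.neg-injective))) (fz w w∈)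

module _ {F : ClauseSet} (U : UHit F) (ns : NoOnce F) {x : Lit} {B₁ B₂ : Clause}
  (B₁∈F : B₁ ∈ F) (B₂∈F : B₂ ∈ F) (x∈B₁ : x ∈ B₁) (x∈B₂ : x ∈ B₂)
  (B₁≢B₂ : B₁ ≢ B₂) (only : ∀ D → D ∈ F → x ∈ D → D ≡ B₁ ⊎ D ≡ B₂) where

  private
    open UHit U
    T = restrict F x
    x≢0 = ≢0 B₁∈F x∈B₁
    UT = restrict-uhit x≢0 U
    module M₁ = TwoClauses U B₁∈F B₂∈F x∈B₁ x∈B₂ B₁≢B₂ only
    module M₂ = TwoClauses U B₂∈F B₁∈F x∈B₂ x∈B₁ (B₁≢B₂ ∘ sym) (λ D D∈F x∈D → [ inj₂ , inj₁ ]′ (only D D∈F x∈D))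
    open M₁ using (Common)

    -- In `F` the literal has a second clause. It did not survive the restriction, so it contains
    -- `x` and is `B₁` or `B₂`.
    once⇒∈B : ∀ z → Once T z → (z ∈ B₁ ⊎ z ∈ B₂) × z ≢ x × z ≢ - x
    once⇒∈B z (E′ , E′∈ , z∈E′ , onlyE′) with ∈-restrict⁻ {F} E′∈ | restrict-∌ {F} E′∈ z∈E′
    ... | E , E∈F , x∉E , refl | z≢x , z≢-x with another (ns z) E∈F (proj₁ (∈-remove⁻ E z∈E′))
    ... | D , D∈F , z∈D , D≢E with x ∈ℤ? D
    ... | yes x∈D = [ (λ e → inj₁ (subst (z ∈_) e z∈D)) , (λ e → inj₂ (subst (z ∈_) e z∈D)) ]′ (only D D∈F x∈D)
                  , z≢x , z≢-x
    ... | no  x∉D = contradiction (remove-injective x≢0 U D∈F E∈F x∉D x∉E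
                      (onlyE′ _ (∈-restrict⁺ D∈F x∉D) (∈-remove⁺ z∈D z≢-x))) D≢E

    once-in : ∀ {A} → A ∈ F → - x ∈ A → ∃ λ S → length S ≤ 1 × (∀ {z} → z ∈ A → z ≢ - x → Once T z → z ∈ S)
    once-in {A} A∈F -x∈A =
      let S , S≤1 , cover = at-most-one (λ z → once? {T} {z} (UHit.unique UT)) (remove (- x) A)
            (once-injective UT (∈-restrict⁺ A∈F λ x∈A → consistent A∈F x x∈A -x∈A))
      in S , S≤1 , λ z∈A z≢-x → cover (∈-remove⁺ z∈A z≢-x)

    free? : ∀ A → Decidable (λ z → z ≢ x × z ∉ A)
    free? A z = ¬? (z ℤ.≟ x) ×-dec ¬? (z ∈ℤ? A)

    both-meet : ∀ {A φ₁ φ₂} → A ∈ F → - x ∈ A → Common B₁ A φ₁ → Common B₂ A φ₂ → ∃ λ S → length S ≤ 3 × CoversOnce S T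
    both-meet {A} A∈F -x∈A com₁ com₂ =
      let S₀ , S₀≤1 , c₀ = once-in A∈F -x∈A
          S₁ , S₁≤1 , c₁ = at-most-one (free? A) B₁ (M₁.free-unique A∈F -x∈A com₁)
          S₂ , S₂≤1 , c₂ = at-most-one (free? A) B₂ (M₂.free-unique A∈F -x∈A com₂)
      in S₀ ++ S₁ ++ S₂
       , (begin
           length (S₀ ++ S₁ ++ S₂)              ≡⟨ length-++ S₀ ⟩
           length S₀ + length (S₁ ++ S₂)        ≡⟨ cong (length S₀ +_) (length-++ S₁) ⟩
           length S₀ + (length S₁ + length S₂)  ≤⟨ ℕₚ.+-mono-≤ S₀≤1 (ℕₚ.+-mono-≤ S₁≤1 S₂≤1) ⟩
           3                                    ∎)
       , λ z once-z → cover S₀ S₁ S₂ c₀ c₁ c₂ z once-z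
      where
      open ℕₚ.≤-Reasoning
      cover : ∀ S₀ S₁ S₂ → (∀ {z} → z ∈ A → z ≢ - x → Once T z → z ∈ S₀) →
        (∀ {z} → z ∈ B₁ → z ≢ x × z ∉ A → z ∈ S₁) → (∀ {z} → z ∈ B₂ → z ≢ x × z ∉ A → z ∈ S₂) → CoversOnce (S₀ ++ S₁ ++ S₂) T
      cover S₀ S₁ S₂ c₀ c₁ c₂ z once-z with z ∈ℤ? A | once⇒∈B z once-z
      ... | yes z∈A | _ , _ , z≢-x = ∈-++⁺ˡ (c₀ z∈A z≢-x once-z)
      ... | no z∉A | inj₁ z∈B₁ , z≢x , _ = ∈-++⁺ʳ S₀ (∈-++⁺ˡ (c₁ z∈B₁ (z≢x , z∉A)))
      ... | no z∉A | inj₂ z∈B₂ , z≢x , _ = ∈-++⁺ʳ S₀ (∈-++⁺ʳ S₁ (c₂ z∈B₂ (z≢x , z∉A)))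

    common? : ∀ {B A} → B ∈ F → A ∈ F → Dec (∃ (Common B A))
    common? {B} {A} B∈F A∈F with clash? (remove x B) (remove (- x) A)
    ... | no ¬clash = yes (clash-free⇒common (con B∈F) (con A∈F) λ y∈ -y∈ → ¬clash (_ , y∈ , -y∈))
      where
      con : ∀ {C y} → C ∈ F → Consistent (remove y C)
      con {C} C∈F z z∈ -z∈ = consistent C∈F z (proj₁ (∈-remove⁻ C z∈)) (proj₁ (∈-remove⁻ C -z∈))
    ... | yes (y , y∈ , -y∈) = no λ where
          (φ , fB , fA) → contradiction (trans (sym (fB y y∈))
            (value-neg-true φ (≢0 B∈F (proj₁ (∈-remove⁻ B y∈))) (fA (- y) -y∈))) λ ()

    partner : ∀ {B} → B ∈ F → x ∈ B → ∃ λ A → A ∈ F × - x ∈ A × ∃ (Common B A)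
    partner {B} B∈F x∈B =
      let φ , fB = point B∈F
          f = λ z z∈ → fB z (proj₁ (∈-remove⁻ B z∈))
          A , A∈F , -x∈A , fA = cross U B∈F x∈B f
      in A , A∈F , -x∈A , φ , f , fA

  -- If some clause A ∋ - x shares an assignment with both B₁ and B₂ (up to x), the literals are the one in A
  -- and one in each Bᵢ ∖ A; otherwise B₁ and B₂ are contained in two such clauses, which contribute one each.
  three-once : ∃ λ S → length S ≤ 3 × CoversOnce S T
  three-once with partner B₁∈F x∈B₁ | partner B₂∈F x∈B₂
  ... | A₁ , A₁∈F , -x∈A₁ , φ₁ , com₁ | A₂ , A₂∈F , -x∈A₂ , φ₂ , com₂ with common? B₁∈F A₂∈F | common? B₂∈F A₁∈F
  ... | yes (_ , com) | _ = both-meet A₂∈F -x∈A₂ com com₂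
  ... | no _ | yes (_ , com) = both-meet A₁∈F -x∈A₁ com₁ com
  ... | no ¬com₁₂ | no ¬com₂₁ =
      let S₁ , S₁≤1 , c₁ = once-in A₁∈F -x∈A₁
          S₂ , S₂≤1 , c₂ = once-in A₂∈F -x∈A₂
      in S₁ ++ S₂
       , ℕₚ.≤-trans (ℕₚ.≤-reflexive (length-++ S₁)) (ℕₚ.≤-trans (ℕₚ.+-mono-≤ S₁≤1 S₂≤1) (ℕₚ.n≤1+n 2))
       , λ z once-z → cover S₁ S₂ c₁ c₂ z once-z
    where
    cover : ∀ S₁ S₂ → (∀ {z} → z ∈ A₁ → z ≢ - x → Once T z → z ∈ S₁) →
      (∀ {z} → z ∈ A₂ → z ≢ - x → Once T z → z ∈ S₂) → CoversOnce (S₁ ++ S₂) T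
    cover S₁ S₂ c₁ c₂ z once-z with z ∈ℤ? A₁ | z ∈ℤ? A₂ | once⇒∈B z once-z
    ... | yes z∈A₁ | _ | _ , _ , z≢-x = ∈-++⁺ˡ (c₁ z∈A₁ z≢-x once-z)
    ... | no _ | yes z∈A₂ | _ , _ , z≢-x = ∈-++⁺ʳ S₁ (c₂ z∈A₂ z≢-x once-z)
    -- A literal of `B₁` outside `A₁` would give `B₂` and `A₁` a common assignment up to `x` by
    -- `free-shift`, which this case excludes; likewise below with the indices exchanged.
    ... | no z∉A₁ | no _ | inj₁ z∈B₁ , z≢x , _ =
          contradiction (_ , M₁.free-shift A₁∈F -x∈A₁ com₁ z∈B₁ z≢x z∉A₁) ¬com₂₁
    ... | no _ | no z∉A₂ | inj₂ z∈B₂ , z≢x , _ =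
          contradiction (_ , M₂.free-shift A₂∈F -x∈A₂ com₂ z∈B₂ z≢x z∉A₂) ¬com₁₂

-- The assumption on smaller deficiencies starts at three, but a part of a factorisation may have
-- deficiency two.
bound-2 : Bound 2
bound-2 {F} U ns def with 1 ℕ.≤? nv F
... | no n<1 = ℕₚ.≤-trans (ℕₚ.+-monoˡ-≤ 5 (ℕₚ.≤-pred (ℕₚ.≰⇒> n<1))) (ℕₚ.m≤m+n 5 3)
... | yes n≥1 with minDegree-exists U n≥1
... | B₁ , x , B₁∈F , x∈B₁ , min with another (ns x) B₁∈F x∈B₁
... | B₂ , B₂∈F , x∈B₂ , B₂≢B₁ = result
  where
  open ℕₚ.≤-Reasoning
  x? : Decidable (x ∈_)
  x? C = x ∈ℤ? C
  T = restrict F x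
  UT = restrict-uhit (UHit.≢0 U B₁∈F x∈B₁) U
  deg≤2 : ldeg F x ≤ 2
  deg≤2 = ℕₚ.+-cancelˡ-≤ (nv F) _ _ (subst (nv F + ldeg F x ≤_) def (minDegree-ldeg U B₁∈F x∈B₁ min))
  deg≡2 : ldeg F x ≡ 2
  deg≡2 = ℕₚ.≤-antisym deg≤2
    (length≥2 (∈-filter⁺ x? B₁∈F x∈B₁) (∈-filter⁺ x? B₂∈F x∈B₂) (B₂≢B₁ ∘ sym))
  only : ∀ D → D ∈ F → x ∈ D → D ≡ B₁ ⊎ D ≡ B₂
  only D D∈F x∈D with D ≟ᶜ B₁ | D ≟ᶜ B₂
  ... | yes e | _ = inj₁ e
  ... | no _ | yes e = inj₂ e
  ... | no ne₁ | no ne₂ = contradiction deg≤2 (ℕₚ.<⇒≱ (unique-⊆⇒length≤ {xs = D ∷ B₁ ∷ B₂ ∷ []}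
          ((ne₁ ∷ ne₂ ∷ []) ∷ ((B₂≢B₁ ∘ sym) ∷ []) ∷ [] ∷ []) λ where
            (here refl) → ∈-filter⁺ x? D∈F x∈D
            (there (here refl)) → ∈-filter⁺ x? B₁∈F x∈B₁
            (there (there (here refl))) → ∈-filter⁺ x? B₂∈F x∈B₂))
  nvF = nv-restrict B₁∈F x∈B₁ (minDegree-keepsVars U B₁∈F x∈B₁ min)
  defT : HasDeficiency T 1
  defT = ℕₚ.+-cancelʳ-≡ 2 _ _ (trans (trans (cong (cc T +_) (sym deg≡2)) (cc-restrict F x))
    (trans def (trans (cong (_+ 2) nvF) (cong (_+ 2) (ℕₚ.+-comm 1 (nv T))))))
  result : nv F + 5 ≤ 8
  result with 2 ℕ.≤? cc T
  ... | no ¬two = begin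
    nv F + 5          ≡⟨ cong (_+ 5) nvF ⟩
    suc (nv T) + 5    ≡⟨ cong (_+ 5) (trans (ℕₚ.+-comm 1 (nv T)) (sym defT)) ⟩
    cc T + 5          ≤⟨ ℕₚ.+-monoˡ-≤ 5 (ℕₚ.≤-pred (ℕₚ.≰⇒> ¬two)) ⟩
    6                 ≤⟨ ℕₚ.m≤m+n 6 2 ⟩
    8                 ∎
  ... | yes two with three-once U ns B₁∈F B₂∈F x∈B₁ x∈B₂ (B₂≢B₁ ∘ sym) only
  ... | S , S≤3 , cover = begin
    nv F + 5          ≡⟨ cong (_+ 5) nvF ⟩
    suc (nv T + 5)    ≤⟨ s≤s (nv-bound S UT two defT (λ where (s≤s ())) cover) ⟩
    5 + length S      ≤⟨ ℕₚ.+-monoʳ-≤ 5 S≤3 ⟩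
    8                 ∎

-- Clause-factors

literalsOver : List ℕ → List Lit
literalsOver vs = map ℤ.+_ vs ++ map (λ v → - (ℤ.+ v)) vs

∈-literalsOver : ∀ {vs} z → ∣ z ∣ ∈ vs → z ∈ literalsOver vs
∈-literalsOver (ℤ.+ v) p = ∈-++⁺ˡ (∈-map⁺ ℤ.+_ p)
∈-literalsOver {vs} ℤ.-[1+ v ] p = ∈-++⁺ʳ (map ℤ.+_ vs) (∈-map⁺ (λ v → - (ℤ.+ v)) p)

length-literalsOver : ∀ vs → length (literalsOver vs) ≡ length vs + length vs
length-literalsOver vs = trans (length-++ (map ℤ.+_ vs)) (cong₂ _+_ (length-map _ vs) (length-map _ vs))

positive-deficiency : ∀ {F} → UHit F → ∃ λ j → HasDeficiency F (suc j)
positive-deficiency {F} U = let j , e = ℕₚ.m≤n⇒∃[o]m+o≡n (deficiency≥1 U) in j , sym (trans (ℕₚ.+-suc (nv F) j) e)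

-- F is F₀ with the clause I = ⋂ F′ replaced by I ∪ C for C in the core F₁ of F′.
module Factor {F F′ : ClauseSet} (U : UHit F) (ns : NoOnce F) (F′! : Unique F′) (F′⊆F : ∀ {C} → C ∈ F′ → C ∈ F)
  (core-covering : Covering (core F′)) (two : 2 ≤ length F′) {E : Clause} (E∈F : E ∈ F) (E∉F′ : E ∉ F′) where

  open UHit U

  private
    inAll : Lit → Set
    inAll x = All (x ∈_) F′

    outside? : Decidable (_∉ F′)
    outside? C = ¬? (C ∈ᶜ? F′)

    member : ∃ (_∈ F′)
    member = length>0⇒∃∈ (ℕₚ.≤-trans (s≤s z≤n) two)

    C₀ : Clause
    C₀ = proj₁ member

    C₀∈F′ : C₀ ∈ F′
    C₀∈F′ = proj₂ member

    I : Clause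
    I = filter (inAll? F′) C₀

    coreOf : Clause → Clause
    coreOf = filter (λ x → ¬? (inAll? F′ x))

    F₀ F₁ : ClauseSet
    F₀ = I ∷ filter outside? F
    F₁ = core F′

    I⊆ : ∀ {C z} → C ∈ F′ → z ∈ I → z ∈ C
    I⊆ C∈F′ z∈I = All.lookup (proj₂ (∈-filter⁻ (inAll? F′) {xs = C₀} z∈I)) C∈F′

    ∈-coreOf⁻ : ∀ {C z} → z ∈ coreOf C → z ∈ C × ¬ inAll z
    ∈-coreOf⁻ {C} = ∈-filter⁻ (λ x → ¬? (inAll? F′ x)) {xs = C}

    ∈-coreOf⁺ : ∀ {C z} → z ∈ C → ¬ inAll z → z ∈ coreOf C
    ∈-coreOf⁺ = ∈-filter⁺ (λ x → ¬? (inAll? F′ x))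

    split : ∀ {C z} → z ∈ C → z ∈ I ⊎ z ∈ coreOf C
    split {C} {z} z∈C with inAll? F′ z
    ... | yes all = inj₁ (∈-filter⁺ (inAll? F′) (All.lookup all C₀∈F′) all)
    ... | no ¬all = inj₂ (∈-coreOf⁺ z∈C ¬all)

    ∈F₁⁻ : ∀ {D} → D ∈ F₁ → ∃ λ C → C ∈ F′ × D ≡ coreOf C
    ∈F₁⁻ = ∈-map⁻ coreOf

    ∈F₁⁺ : ∀ {C} → C ∈ F′ → coreOf C ∈ F₁
    ∈F₁⁺ = ∈-map⁺ coreOf

    ∈F₀⁺ : ∀ {C} → C ∈ F → C ∉ F′ → C ∈ F₀
    ∈F₀⁺ C∈F C∉F′ = there (∈-filter⁺ outside? C∈F C∉F′)

    falsifies-I : ∀ {φ C} → C ∈ F′ → Falsifies φ C → Falsifies φ I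
    falsifies-I C∈F′ fC z z∈I = fC z (I⊆ C∈F′ z∈I)

    falsifies-coreOf : ∀ {φ C} → Falsifies φ C → Falsifies φ (coreOf C)
    falsifies-coreOf {C = C} fC z z∈ = fC z (proj₁ (∈-coreOf⁻ {C} z∈))

    falsifies-join : ∀ {φ C} → Falsifies φ I → Falsifies φ (coreOf C) → Falsifies φ C
    falsifies-join fI fcore z z∈C = [ fI z , fcore z ]′ (split z∈C)

    falsifies-member : ∀ {φ} → Falsifies φ I → ∃ λ C → C ∈ F′ × Falsifies φ C
    falsifies-member {φ} fI with core-covering φ
    ... | _ , D∈F₁ , fD with ∈F₁⁻ D∈F₁
    ... | C , C∈F′ , refl = C , C∈F′ , falsifies-join {C = C} fI fD

    wf-I : WfClause I
    wf-I = wf-filter (inAll? F′) (All.lookup wf (F′⊆F C₀∈F′))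

    -- Where `I` is falsified, the covering core supplies a falsified member of `F′`; by
    -- disjointness `D` would be that member.
    I-outside : ∀ {φ D} → D ∈ F → D ∉ F′ → Falsifies φ I → ¬ Falsifies φ D
    I-outside {φ} {D} D∈F D∉F′ fI fD with falsifies-member {φ} fI
    ... | C , C∈F′ , fC = D∉F′ (subst (_∈ F′) (disjoint φ (F′⊆F C∈F′) D∈F fC fD) C∈F′)

    U₀ : UHit F₀
    U₀ = record { wf = wf-I ∷ Allₚ.filter⁺ outside? wf ; unique = ∉⇒unique-∷ I∉ (Uniqueₚ.filter⁺ outside? unique)
                ; covering = cov ; disjoint = disj }
      where
      I∉ : I ∉ filter outside? F
      I∉ I∈ = let I∈F , I∉F′ = ∈-filter⁻ outside? {xs = F} I∈
                  f = falsifying-∈ (λ _ → false) (proj₂ (proj₂ wf-I))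
              in I-outside {D = I} I∈F I∉F′ f f
      cov : Covering F₀
      cov φ with covering φ
      ... | C , C∈F , fC with C ∈ᶜ? F′
      ... | yes C∈F′ = I , here refl , falsifies-I C∈F′ fC
      ... | no  C∉F′ = C , ∈F₀⁺ C∈F C∉F′ , fC
      disj : ∀ φ {C D} → C ∈ F₀ → D ∈ F₀ → Falsifies φ C → Falsifies φ D → C ≡ D
      disj φ (here refl) (here refl) fC fD = refl
      disj φ (here refl) (there D∈)  fC fD = let D∈F , D∉ = ∈-filter⁻ outside? {xs = F} D∈ in
        contradiction fD (I-outside D∈F D∉ fC)
      disj φ (there C∈)  (here refl) fC fD = let C∈F , C∉ = ∈-filter⁻ outside? {xs = F} C∈ in
        contradiction fC (I-outside C∈F C∉ fD)
      disj φ (there C∈)  (there D∈)  fC fD =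
        disjoint φ (proj₁ (∈-filter⁻ outside? C∈)) (proj₁ (∈-filter⁻ outside? D∈)) fC fD

    -- `I` and the core of a member of `F′` come from the same clause and do not clash. So `I` can
    -- be falsified in addition, which falsifies the full clauses.
    core-disjoint : ∀ φ {C D} → C ∈ F′ → D ∈ F′ → Falsifies φ (coreOf C) → Falsifies φ (coreOf D) → C ≡ D
    core-disjoint φ {C} {D} C∈F′ D∈F′ fC fD =
      disjoint (falsifying I φ) (F′⊆F C∈F′) (F′⊆F D∈F′) (lift C∈F′ fC) (lift D∈F′ fD)
      where
      lift : ∀ {C} → C ∈ F′ → Falsifies φ (coreOf C) → Falsifies (falsifying I φ) C
      lift {C} C∈F′ f = falsifies-join {C = C} (falsifying-∈ φ (proj₂ (proj₂ wf-I)))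
        (falsifying-keeps φ (proj₂ (proj₂ wf-I)) f λ z∈ -z∈I →
          consistent (F′⊆F C∈F′) _ (proj₁ (∈-coreOf⁻ {C} z∈)) (I⊆ C∈F′ -z∈I))

    coreOf-injective : ∀ {C D} → C ∈ F′ → D ∈ F′ → coreOf C ≡ coreOf D → C ≡ D
    coreOf-injective {C} C∈F′ D∈F′ e = let φ , fC = point (F′⊆F C∈F′)
                                           f = falsifies-coreOf {C = C} fC
                                       in core-disjoint φ C∈F′ D∈F′ f (subst (Falsifies φ) e f)

    U₁ : UHit F₁
    U₁ = record { wf = wf₁ ; unique = unique-map coreOf F′! coreOf-injective ; covering = core-covering ; disjoint = disj }
      where
      wf₁ : All WfClause F₁
      wf₁ = All.tabulate λ D∈ → let C , C∈F′ , e = ∈F₁⁻ D∈ in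
              subst WfClause (sym e) (wf-filter _ (All.lookup wf (F′⊆F C∈F′)))
      disj : ∀ φ {C D} → C ∈ F₁ → D ∈ F₁ → Falsifies φ C → Falsifies φ D → C ≡ D
      disj φ C∈ D∈ fC fD with ∈F₁⁻ C∈ | ∈F₁⁻ D∈
      ... | C , C∈F′ , refl | D , D∈F′ , refl = cong coreOf (core-disjoint φ C∈F′ D∈F′ fC fD)

    shared? : Decidable (_∈ vars F₀)
    shared? v = v ∈ℕ? vars F₀

  shared : List ℕ
  shared = filter shared? (vars F₁)

  -- A literal in some but not all members of `F′` stays in the core; an occurrence outside `F′`
  -- puts its variable into `F₀` as well.
  shared-nonempty : ∀ {C C′ D z} → C ∈ F′ → z ∈ C → C′ ∈ F′ → z ∉ C′ → D ∈ F → D ∉ F′ → z ∈ D → 1 ≤ length shared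
  shared-nonempty {C} C∈F′ z∈C C′∈F′ z∉C′ D∈F D∉F′ z∈D = ∈-length (∈-filter⁺ shared?
    (∈-vars⁺ (∈F₁⁺ C∈F′) (∈-coreOf⁺ z∈C λ all → z∉C′ (All.lookup all C′∈F′)))
    (∈-vars⁺ (∈F₀⁺ D∈F D∉F′) z∈D))

  private
    cc-sum : cc F₀ + cc F₁ ≡ suc (cc F)
    cc-sum = cong suc (trans (cong (length (filter outside? F) +_) cc₁) (length-filter-¬ (_∈ᶜ? F′) F))
      where
      cc₁ : cc F₁ ≡ length (filter (_∈ᶜ? F′) F)
      cc₁ = trans (length-map coreOf F′) (unique-≐⇒length≡ F′! (Uniqueₚ.filter⁺ (_∈ᶜ? F′) unique)
        (λ C∈F′ → ∈-filter⁺ (_∈ᶜ? F′) (F′⊆F C∈F′) C∈F′) (λ C∈ → proj₂ (∈-filter⁻ (_∈ᶜ? F′) {xs = F} C∈)))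

    nv-sum : nv F + length shared ≡ nv F₀ + nv F₁
    nv-sum = begin
      nv F + length shared                              ≡⟨ cong (_+ length shared) nvF ⟩
      length (vars F₀ ++ private₁) + length shared      ≡⟨ cong (_+ length shared) (length-++ (vars F₀)) ⟩
      nv F₀ + length private₁ + length shared           ≡⟨ ℕₚ.+-assoc (nv F₀) _ _ ⟩
      nv F₀ + (length private₁ + length shared)         ≡⟨ cong (nv F₀ +_) (length-filter-¬ shared? (vars F₁)) ⟩
      nv F₀ + nv F₁                                     ∎
      where
      open ≡-Reasoning
      private₁ = filter (¬? ∘ shared?) (vars F₁)
      to : ∀ {v} → v ∈ vars F → v ∈ vars F₀ ++ private₁
      to v∈ with ∈-vars⁻ F v∈
      ... | C , x , C∈F , x∈C , refl with shared? ∣ x ∣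
      ... | yes p = ∈-++⁺ˡ p
      ... | no ¬p with C ∈ᶜ? F′
      ... | no C∉F′ = contradiction (∈-vars⁺ (∈F₀⁺ C∈F C∉F′) x∈C) ¬p
      ... | yes C∈F′ with split x∈C
      ... | inj₁ x∈I = contradiction (∈-vars⁺ {F₀} (here refl) x∈I) ¬p
      ... | inj₂ x∈core = ∈-++⁺ʳ (vars F₀) (∈-filter⁺ (¬? ∘ shared?) (∈-vars⁺ (∈F₁⁺ C∈F′) x∈core) ¬p)
      from₀ : ∀ {v} → v ∈ vars F₀ → v ∈ vars F
      from₀ v∈ with ∈-vars⁻ F₀ v∈
      ... | _ , x , here refl , x∈I , refl = ∈-vars⁺ (F′⊆F C₀∈F′) (I⊆ C₀∈F′ x∈I)
      ... | C , x , there C∈ , x∈C , refl = ∈-vars⁺ (proj₁ (∈-filter⁻ outside? {xs = F} C∈)) x∈C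
      from₁ : ∀ {v} → v ∈ vars F₁ → v ∈ vars F
      from₁ v∈ with ∈-vars⁻ F₁ v∈
      ... | D , x , D∈ , x∈D , refl with ∈F₁⁻ D∈
      ... | C , C∈F′ , refl = ∈-vars⁺ (F′⊆F C∈F′) (proj₁ (∈-coreOf⁻ {C} x∈D))
      nvF : nv F ≡ length (vars F₀ ++ private₁)
      nvF = unique-≐⇒length≡ (vars-unique F)
        (Uniqueₚ.++⁺ (vars-unique F₀) (Uniqueₚ.filter⁺ (¬? ∘ shared?) (vars-unique F₁))
          λ where (p , q) → proj₂ (∈-filter⁻ (¬? ∘ shared?) {xs = vars F₁} q) p)
        to (λ v∈ → [ from₀ , (λ q → from₁ (proj₁ (∈-filter⁻ (¬? ∘ shared?) q))) ]′ (∈-++⁻ (vars F₀) v∈))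

    lits = literalsOver shared

    ∈lits : ∀ z → ∣ z ∣ ∈ vars F₀ → ∣ z ∣ ∈ vars F₁ → z ∈ lits
    ∈lits z p q = ∈-literalsOver z (∈-filter⁺ shared? q p)

    -- A literal over an unshared variable occurs neither outside `F′` nor in `I`, so it has the
    -- same degree in `F₁` as in `F`, which is not one.
    cover₁ : CoversOnce lits F₁
    cover₁ z (D , D∈ , z∈D , only) with shared? ∣ z ∣ | ∈F₁⁻ D∈
    ... | yes p | _ = ∈lits z p (∈-vars⁺ D∈ z∈D)
    ... | no ¬p | C , C∈F′ , refl = contradiction (C , F′⊆F C∈F′ , proj₁ (∈-coreOf⁻ {C} z∈D) , onlyC) (ns z)
      where
      onlyC : ∀ B → B ∈ F → z ∈ B → B ≡ C
      onlyC B B∈F z∈B with B ∈ᶜ? F′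
      ... | no B∉F′ = contradiction (∈-vars⁺ (∈F₀⁺ B∈F B∉F′) z∈B) ¬p
      ... | yes B∈F′ with split z∈B
      ... | inj₁ z∈I = contradiction (∈-vars⁺ {F₀} (here refl) z∈I) ¬p
      ... | inj₂ z∈core = coreOf-injective B∈F′ C∈F′ (only _ (∈F₁⁺ B∈F′) z∈core)

    -- The same comparison works for literals outside `I`. Those in `I` may lose degree when the
    -- members of `F′` collapse to `I`, and `once-injective` leaves at most one of them.
    cover₀ : ∃ λ S → length S ≤ 1 × CoversOnce (S ++ lits) F₀
    cover₀ with at-most-one (λ z → once? {F₀} {z} (UHit.unique U₀)) I (once-injective U₀ (here refl))
    ... | S , S≤1 , coverI = S , S≤1 , cover
      where
      cover : CoversOnce (S ++ lits) F₀
      cover z o@(D , D∈ , z∈D , only) with z ∈ℤ? I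
      ... | yes z∈I = ∈-++⁺ˡ (coverI z∈I o)
      ... | no  z∉I with ∣ z ∣ ∈ℕ? vars F₁ | D∈
      ... | yes p | _ = ∈-++⁺ʳ S (∈lits z (∈-vars⁺ D∈ z∈D) p)
      ... | no ¬p | here refl = contradiction z∈D z∉I
      ... | no ¬p | there D∈′ = contradiction (D , proj₁ (∈-filter⁻ outside? {xs = F} D∈′) , z∈D , onlyD) (ns z)
        where
        onlyD : ∀ B → B ∈ F → z ∈ B → B ≡ D
        onlyD B B∈F z∈B with B ∈ᶜ? F′
        ... | no B∉F′ = only B (∈F₀⁺ B∈F B∉F′) z∈B
        ... | yes B∈F′ with split z∈B
        ... | inj₁ z∈I = contradiction z∈I z∉I
        ... | inj₂ z∈core = contradiction (∈-vars⁺ (∈F₁⁺ B∈F′) z∈core) ¬p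

    two₀ : 2 ≤ cc F₀
    two₀ = s≤s (∈-length (∈-filter⁺ outside? E∈F E∉F′))

    two₁ : 2 ≤ cc F₁
    two₁ = subst (2 ≤_) (sym (length-map coreOf F′)) two

  -- With `s` shared variables each part has at most `2s` degree-one literals over them, plus one
  -- more in `F₀`. In the sum of the two bounds these `4s` cancel against the deficiency `s` lost in
  -- the splitting.
  factor-bound : ∀ {k} → HasDeficiency F k → (∀ j → 2 ≤ j → j < k → Bound j) → nv F + length shared + 5 ≤ 4 * k
  factor-bound {k} def bounds with positive-deficiency U₀ | positive-deficiency U₁ | cover₀
  ... | j₀ , def₀ | j₁ , def₁ | S , S≤1 , cov₀ = ℕₚ.+-cancelʳ-≤ 5 _ _ (begin
    nv F + s + 5 + 5                                       ≡⟨ cong (λ n → n + 5 + 5) nv-sum ⟩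
    nv F₀ + nv F₁ + 5 + 5                                  ≡⟨ regroup (nv F₀) (nv F₁) ⟩
    (nv F₀ + 5) + (nv F₁ + 5)                              ≤⟨ ℕₚ.+-mono-≤ (bound₀ λ p → bounds _ p k₀<k) (bound₁ λ p → bounds _ p k₁<k) ⟩
    (4 * suc j₀ + suc (s + s)) + (4 * suc j₁ + (s + s))    ≡⟨ collect j₀ j₁ s ⟩
    4 * suc (j₀ + j₁ + s) + 5                              ≡⟨ cong (λ k → 4 * k + 5) k≡ ⟨
    4 * k + 5                                              ∎)
    where
    open ℕₚ.≤-Reasoning
    s = length shared
    regroup : ∀ a b → a + b + 5 + 5 ≡ (a + 5) + (b + 5)
    regroup = solve-∀
    collect : ∀ a b c → (4 * suc a + suc (c + c)) + (4 * suc b + (c + c)) ≡ 4 * suc (a + b + c) + 5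
    collect = solve-∀
    k≡ : k ≡ suc (j₀ + j₁ + s)
    k≡ = ℕₚ.+-cancelˡ-≡ (suc (nv F)) _ _ (trans (cong suc (sym def)) (trans (sym cc-sum) (trans (cong₂ _+_ def₀ def₁)
      (trans (gather (nv F₀) (nv F₁) j₀ j₁) (trans (cong (λ n → n + suc (suc (j₀ + j₁))) (sym nv-sum)) (spread (nv F) s j₀ j₁))))))
      where
      gather : ∀ a b c d → (a + suc c) + (b + suc d) ≡ (a + b) + suc (suc (c + d))
      gather = solve-∀
      spread : ∀ n s a b → (n + s) + suc (suc (a + b)) ≡ suc n + suc (a + b + s)
      spread = solve-∀
    bound₁ : (2 ≤ suc j₁ → Bound (suc j₁)) → nv F₁ + 5 ≤ 4 * suc j₁ + (s + s)
    bound₁ b = subst (λ l → nv F₁ + 5 ≤ 4 * suc j₁ + l) (length-literalsOver shared) (nv-bound lits U₁ two₁ def₁ b cover₁)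
    bound₀ : (2 ≤ suc j₀ → Bound (suc j₀)) → nv F₀ + 5 ≤ 4 * suc j₀ + suc (s + s)
    bound₀ b = ℕₚ.≤-trans (nv-bound (S ++ lits) U₀ two₀ def₀ b cov₀) (ℕₚ.+-monoʳ-≤ (4 * suc j₀)
      (ℕₚ.≤-trans (ℕₚ.≤-reflexive (trans (length-++ S) (cong (length S +_) (length-literalsOver shared))))
                  (ℕₚ.+-monoˡ-≤ (s + s) S≤1)))
    -- A factorisation with no shared variable and a part of deficiency one contradicts the bound for that part.
    positive₀ : 1 ≤ j₁ + s
    positive₀ = ℕₚ.≮⇒≥ λ where
      (s≤s z) → let j₁≡0 = ℕₚ.m+n≡0⇒m≡0 j₁ (ℕₚ.n≤0⇒n≡0 z)
                    s≡0 = ℕₚ.m+n≡0⇒n≡0 j₁ (ℕₚ.n≤0⇒n≡0 z)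
                in contradiction (ℕₚ.≤-trans (ℕₚ.m≤n+m 5 (nv F₁))
                     (subst (nv F₁ + 5 ≤_) (cong₂ (λ j s → 4 * suc j + (s + s)) j₁≡0 s≡0)
                       (bound₁ λ p → contradiction p (subst (λ j → ¬ 2 ≤ suc j) (sym j₁≡0) λ where (s≤s ())))))
                   λ where (s≤s (s≤s (s≤s (s≤s ()))))
    positive₁ : 1 ≤ j₀ + s
    positive₁ = ℕₚ.≮⇒≥ λ where
      (s≤s z) → let j₀≡0 = ℕₚ.m+n≡0⇒m≡0 j₀ (ℕₚ.n≤0⇒n≡0 z)
                    s≡0 = ℕₚ.m+n≡0⇒n≡0 j₀ (ℕₚ.n≤0⇒n≡0 z)
                    -- The additional literal in `I` makes the right-hand side five here, so the
                    -- contradiction needs a variable in `F₀`; two clauses in deficiency one force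
                    -- it.
                    nv₀≥1 = ℕₚ.+-cancelʳ-≤ 1 1 (nv F₀) (subst (2 ≤_) (trans def₀ (cong (λ j → nv F₀ + suc j) j₀≡0)) two₀)
                in contradiction (ℕₚ.≤-trans (ℕₚ.+-monoˡ-≤ 5 nv₀≥1)
                     (subst (nv F₀ + 5 ≤_) (cong₂ (λ j s → 4 * suc j + suc (s + s)) j₀≡0 s≡0)
                       (bound₀ λ p → contradiction p (subst (λ j → ¬ 2 ≤ suc j) (sym j₀≡0) λ where (s≤s ())))))
                   λ where (s≤s (s≤s (s≤s (s≤s (s≤s ())))))
    k₀<k : suc j₀ < k
    k₀<k = begin-strict
      suc j₀              <⟨ ℕₚ.m<m+n (suc j₀) positive₀ ⟩
      suc j₀ + (j₁ + s)   ≡⟨ cong suc (ℕₚ.+-assoc j₀ j₁ s) ⟨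
      suc (j₀ + j₁ + s)   ≡⟨ k≡ ⟨
      k                   ∎
    k₁<k : suc j₁ < k
    k₁<k = begin-strict
      suc j₁              <⟨ ℕₚ.m<m+n (suc j₁) positive₁ ⟩
      suc j₁ + (j₀ + s)   ≡⟨ reorder j₀ j₁ s ⟩
      suc (j₀ + j₁ + s)   ≡⟨ k≡ ⟨
      k                   ∎
      where
      reorder : ∀ a b c → suc b + (a + c) ≡ suc (a + b + c)
      reorder = solve-∀

-- Reducible and irreducible clause-sets

unique-sublist : ∀ {A : Set} {xs ys : List A} → xs ⊆ ys → Unique ys → Unique xs
unique-sublist []         []            = []
unique-sublist (_ ∷ʳ p)   (_ ∷ ys!)    = unique-sublist p ys!
unique-sublist (refl ∷ p) (y∉ys ∷ ys!) = All-resp-⊆ p y∉ys ∷ unique-sublist p ys!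

-- A factor missing some clause of `F` is handled by `Factor`. A sublist missing none has full
-- length, hence is `F` itself and trivial.
reducible-bound : ∀ {F F′ k} → UHit F → NoOnce F → HasDeficiency F k → (∀ j → 2 ≤ j → j < k → Bound j) →
  F′ ⊆ F → IsClauseFactor F′ → ¬ TrivialFactor F F′ → nv F + 5 ≤ 4 * k
reducible-bound {F} {F′} {k} U ns def bounds F′⊆F (F′≢[] , unsat) ¬trivial
  with Any.any? (λ C → ¬? (C ∈ᶜ? F′)) F
... | yes p = let E , E∈F , E∉F′ = find p
                  module Fac = Factor U ns (unique-sublist F′⊆F unique) (⊆-lookup F′⊆F)
                                 (unsat⇒covering wf-core unsat) (two F′ F′≢[] (¬trivial ∘ inj₁)) E∈F E∉F′
              in ℕₚ.≤-trans (ℕₚ.+-monoˡ-≤ 5 (ℕₚ.m≤m+n (nv F) (length Fac.shared))) (Fac.factor-bound def bounds)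
  where
  open UHit U
  wf-core : All WfClause (core F′)
  wf-core = All.tabulate λ D∈ → let C , C∈F′ , e = ∈-map⁻ _ D∈ in
    subst WfClause (sym e) (wf-filter _ (All.lookup wf (⊆-lookup F′⊆F C∈F′)))
  two : ∀ F′ → F′ ≢ [] → length F′ ≢ 1 → 2 ≤ length F′
  two []          ne _  = contradiction refl ne
  two (_ ∷ [])    _  ne = contradiction refl ne
  two (_ ∷ _ ∷ _) _  _  = s≤s (s≤s z≤n)
... | no ¬p = contradiction (inj₂ (subst Unsat (sym F′≡F) (covering⇒unsat (UHit.covering U)) , F′≡F)) ¬trivial
  where
  F⊆F′ : ∀ {C} → C ∈ F → C ∈ F′
  F⊆F′ {C} C∈F with C ∈ᶜ? F′
  ... | yes C∈F′ = C∈F′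
  ... | no  C∉F′ = contradiction (lose C∈F C∉F′) ¬p
  F′≡F : F′ ≡ F
  F′≡F = Pointwise-≡⇒≡ (to-≋ (ℕₚ.≤-antisym (length-mono-≤ F′⊆F) (unique-⊆⇒length≤ (UHit.unique U) F⊆F′)) F′⊆F)

-- The clause `C` of `x` without `x` lies in every clause with `- x`, and `cross` makes the core of
-- those clauses covering. This factor omits `C`, so irreducibility leaves only a single clause with
-- `- x`.
irreducible⇒noOnce : ∀ {F} → UHit F → 3 ≤ cc F → ClauseIrreducible F → NoOnce F
irreducible⇒noOnce {F} U three irr x (C , C∈F , x∈C , onlyC) with irr Ds (filter-⊆ nx? F) (Ds≢[] , covering⇒unsat cov)
  where
  open UHit U
  nx? : Decidable (- x ∈_)
  nx? D = - x ∈ℤ? D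
  Ds = filter nx? F
  Ds≢[] : Ds ≢ []
  Ds≢[] e = let D , D∈F , -x∈D = occurs-neg U C∈F x∈C in
    contradiction (subst (D ∈_) e (∈-filter⁺ nx? D∈F -x∈D)) λ ()
  K = remove x C
  K⊆ : ∀ {D z} → D ∈ F → - x ∈ D → z ∈ K → z ∈ D
  K⊆ D∈F -x∈D z∈K = let z∈C , z≢x = ∈-remove⁻ C z∈K in only-clause-⊆ U C∈F x∈C onlyC D∈F -x∈D z∈C z≢x
  cov : Covering (core Ds)
  cov φ with cross U C∈F x∈C (falsifying-∈ {K} φ λ z z∈K -z∈K →
                consistent C∈F z (proj₁ (∈-remove⁻ C z∈K)) (proj₁ (∈-remove⁻ C -z∈K)))
  ... | A , A∈F , -x∈A , fA = _ , ∈-map⁺ _ (∈-filter⁺ nx? A∈F -x∈A) , λ z z∈ →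
      let z∈A , ¬all = ∈-filter⁻ (λ z → ¬? (inAll? Ds z)) {xs = A} z∈
          everywhere : z ≡ - x ⊎ z ∈ K → All (z ∈_) Ds
          everywhere p = All.tabulate λ D∈ → let D∈F , -x∈D = ∈-filter⁻ nx? {xs = F} D∈ in
            [ (λ e → subst (_∈ _) (sym e) -x∈D) , K⊆ D∈F -x∈D ]′ p
      in trans (sym (falsifying-∉ {K} φ (¬all ∘ everywhere ∘ inj₂) (λ -z∈K → consistent A∈F z z∈A (K⊆ A∈F -x∈A -z∈K))))
               (fA z (∈-remove⁺ z∈A (¬all ∘ everywhere ∘ inj₁)))
... | inj₂ (_ , Ds≡F) = UHit.consistent U C∈F x x∈C
        (proj₂ (∈-filter⁻ (λ D → - x ∈ℤ? D) {xs = F} (subst (C ∈_) (sym Ds≡F) C∈F)))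
-- Now `x` and `- x` both have degree one, so `C` and `D` agree apart from these literals and form a
-- factor with core `x`, `- x`. As `3 ≤ cc F`, it is nontrivial.
... | inj₁ one with ldeg≡1⇒once {F} { - x} one
... | D , D∈F , -x∈D , onlyD = [ (λ one → contradiction one (ℕₚ.>⇒≢ (length≥2 C∈P D∈P C≢D)))
                               , (λ where (_ , e) → contradiction three (ℕₚ.<⇒≱ (s≤s (subst (λ G → length G ≤ 2) e short)))) ]′
                               (irr P (filter-⊆ pair? F) (P≢[] , covering⇒unsat cov))
  where
  open UHit U
  pair? : Decidable (λ B → B ≡ C ⊎ B ≡ D)
  pair? B = (B ≟ᶜ C) ⊎-dec (B ≟ᶜ D)
  P = filter pair? F
  C∈P = ∈-filter⁺ pair? C∈F (inj₁ refl)
  D∈P = ∈-filter⁺ pair? D∈F (inj₂ refl)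
  P≢[] : P ≢ []
  P≢[] e = contradiction (subst (C ∈_) e C∈P) λ ()
  C≢D : C ≢ D
  C≢D e = consistent C∈F x x∈C (subst (- x ∈_) (sym e) -x∈D)
  short : length P ≤ 2
  short = unique-⊆⇒length≤ {ys = C ∷ D ∷ []} (Uniqueₚ.filter⁺ pair? unique) λ B∈ →
    [ here , there ∘ here ]′ (proj₂ (∈-filter⁻ pair? {xs = F} B∈))
  inP : ∀ {z} → z ∈ C → z ∈ D → All (z ∈_) P
  inP z∈C z∈D = All.tabulate λ B∈ → [ (λ e → subst (_ ∈_) (sym e) z∈C) , (λ e → subst (_ ∈_) (sym e) z∈D) ]′
    (proj₂ (∈-filter⁻ pair? {xs = F} B∈))
  cov : Covering (core P)
  cov φ with value φ x in e
  ... | false = _ , ∈-map⁺ _ C∈P , λ z z∈ → C-core z (∈-filter⁻ (λ z → ¬? (inAll? P z)) {xs = C} z∈)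
    where
    C-core : ∀ z → z ∈ C × ¬ All (z ∈_) P → value φ z ≡ false
    C-core z (z∈C , ¬all) with z ℤ.≟ x
    ... | yes refl = e
    ... | no  z≢x = contradiction (inP z∈C (only-clause-⊆ U C∈F x∈C onlyC D∈F -x∈D z∈C z≢x)) ¬all
  ... | true = _ , ∈-map⁺ _ D∈P , λ z z∈ → D-core z (∈-filter⁻ (λ z → ¬? (inAll? P z)) {xs = D} z∈)
    where
    D-core : ∀ z → z ∈ D × ¬ All (z ∈_) P → value φ z ≡ false
    D-core z (z∈D , ¬all) with z ℤ.≟ - x
    ... | yes refl = trans (value-neg φ (≢0 C∈F x∈C)) (cong not e)
    ... | no  z≢-x = contradiction (inP (only-clause-⊆ U D∈F -x∈D onlyD C∈F
                       (subst (_∈ C) (sym (ℤₚ.neg-involutive x)) x∈C) z∈D z≢-x) z∈D) ¬all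

-- nfs-flips

≢neg : ∀ {x} → x ≢ ℤ.0ℤ → x ≢ - x
≢neg {x} x≢0 e = singleton-consistent x≢0 x (here refl) (here (sym e))

module Flip {F G : ClauseSet} (U : UHit F) {E C₁ C₂ D₁ D₂ : Clause} {x y : Lit}
  (x≢0 : x ≢ ℤ.0ℤ) (y≢0 : y ≢ ℤ.0ℤ) (∣x∣≢∣y∣ : ∣ x ∣ ≢ ∣ y ∣)
  (x∉E : x ∉ E) (-x∉E : - x ∉ E) (y∉E : y ∉ E) (-y∉E : - y ∉ E)
  (ext-C₁ : IsExt E (x ∷ []) C₁) (ext-C₂ : IsExt E (- x ∷ y ∷ []) C₂)
  (ext-D₁ : IsExt E (x ∷ - y ∷ []) D₁) (ext-D₂ : IsExt E (y ∷ []) D₂)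
  (C₁∈F : C₁ ∈ F) (C₂∈F : C₂ ∈ F) (D₁∉F : D₁ ∉ F) (D₂∉F : D₂ ∉ F) (wf-G : WfCS G)
  (G⇔ : ∀ C → C ∈ G ⇔ ((C ∈ F × C ≢ C₁ × C ≢ C₂) ⊎ C ≡ D₁ ⊎ C ≡ D₂)) where

  open UHit U

  private
    ext⁺ : ∀ {L C z} → IsExt E L C → z ∈ E ⊎ z ∈ L → z ∈ C
    ext⁺ (_ , eqv) = Equivalence.from (eqv _)

    ext⁻ : ∀ {L C z} → IsExt E L C → z ∈ C → z ∈ E ⊎ z ∈ L
    ext⁻ (_ , eqv) = Equivalence.to (eqv _)

    ∈E⇒ : ∀ {L C z} → IsExt E L C → z ∈ E → z ∈ C
    ∈E⇒ ext z∈E = ext⁺ ext (inj₁ z∈E)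

    x∈C₁ = ext⁺ ext-C₁ (inj₂ (here refl))
    -x∈C₂ = ext⁺ ext-C₂ (inj₂ (here refl))
    y∈C₂ = ext⁺ ext-C₂ (inj₂ (there (here refl)))
    x∈D₁ = ext⁺ ext-D₁ (inj₂ (here refl))
    -y∈D₁ = ext⁺ ext-D₁ (inj₂ (there (here refl)))
    y∈D₂ = ext⁺ ext-D₂ (inj₂ (here refl))

    ∣-x∣≢∣y∣ : ∣ - x ∣ ≢ ∣ y ∣
    ∣-x∣≢∣y∣ e = ∣x∣≢∣y∣ (trans (sym (ℤₚ.∣-i∣≡∣i∣ x)) e)

    ∣x∣≢∣-y∣ : ∣ x ∣ ≢ ∣ - y ∣
    ∣x∣≢∣-y∣ e = ∣x∣≢∣y∣ (trans e (ℤₚ.∣-i∣≡∣i∣ y))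

    x∉C₂ : x ∉ C₂
    x∉C₂ p with ext⁻ ext-C₂ p
    ... | inj₁ q = x∉E q
    ... | inj₂ (here e) = ≢neg x≢0 e
    ... | inj₂ (there (here e)) = ∣x∣≢∣y∣ (cong ∣_∣ e)

    y∉C₁ : y ∉ C₁
    y∉C₁ p with ext⁻ ext-C₁ p
    ... | inj₁ q = y∉E q
    ... | inj₂ (here e) = ∣x∣≢∣y∣ (cong ∣_∣ (sym e))

    -y∉C₁ : - y ∉ C₁
    -y∉C₁ p with ext⁻ ext-C₁ p
    ... | inj₁ q = -y∉E q
    ... | inj₂ (here e) = ∣x∣≢∣-y∣ (cong ∣_∣ (sym e))

    -y∉C₂ : - y ∉ C₂
    -y∉C₂ p = consistent C₂∈F y y∈C₂ p

    y∉D₁ : y ∉ D₁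
    y∉D₁ p = proj₂ (proj₂ (proj₁ ext-D₁)) y p -y∈D₁

    -x∉D₁ : - x ∉ D₁
    -x∉D₁ p = proj₂ (proj₂ (proj₁ ext-D₁)) x x∈D₁ p

    -x∉D₂ : - x ∉ D₂
    -x∉D₂ p with ext⁻ ext-D₂ p
    ... | inj₁ q = -x∉E q
    ... | inj₂ (here e) = ∣-x∣≢∣y∣ (cong ∣_∣ e)

    C₁≢C₂ : C₁ ≢ C₂
    C₁≢C₂ e = x∉C₂ (subst (x ∈_) e x∈C₁)

    D₁≢D₂ : D₁ ≢ D₂
    D₁≢D₂ e = y∉D₁ (subst (y ∈_) (sym e) y∈D₂)

    D₁∈G = Equivalence.from (G⇔ D₁) (inj₂ (inj₁ refl))
    D₂∈G = Equivalence.from (G⇔ D₂) (inj₂ (inj₂ refl))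

    old : ∀ {C} → C ∈ F → C ≢ C₁ → C ≢ C₂ → C ∈ G
    old C∈F ne₁ ne₂ = Equivalence.from (G⇔ _) (inj₁ (C∈F , ne₁ , ne₂))

    G⁻ : ∀ {C} → C ∈ G → (C ∈ F × C ≢ C₁ × C ≢ C₂) ⊎ C ≡ D₁ ⊎ C ≡ D₂
    G⁻ = Equivalence.to (G⇔ _)

    neg-false : ∀ {φ z} → z ≢ ℤ.0ℤ → value φ z ≡ true → value φ (- z) ≡ false
    neg-false {φ} z≢0 e = trans (value-neg φ z≢0) (cong not e)

    falsifies-ext : ∀ {L C φ} → IsExt E L C → Falsifies φ E → Falsifies φ L → Falsifies φ C
    falsifies-ext ext fE fL z z∈C = [ fE z , fL z ]′ (ext⁻ ext z∈C)

    falsifies-E : ∀ {L C φ} → IsExt E L C → Falsifies φ C → Falsifies φ E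
    falsifies-E ext fC z z∈E = fC z (∈E⇒ ext z∈E)

    falsifies₁ : ∀ {φ a} → value φ a ≡ false → Falsifies φ (a ∷ [])
    falsifies₁ e _ (here refl) = e

    falsifies₂ : ∀ {φ a b} → value φ a ≡ false → value φ b ≡ false → Falsifies φ (a ∷ b ∷ [])
    falsifies₂ e _ _ (here refl) = e
    falsifies₂ _ e _ (there (here refl)) = e

  -- Both pairs cover the assignments falsifying `E` and at least one of `x`, `y`; `C₁`, `C₂` split
  -- them by the value of `x`, and `D₁`, `D₂` by the value of `y`.
  flip-uhit : UHit G
  flip-uhit = record { wf = proj₁ wf-G ; unique = proj₂ wf-G ; covering = cov ; disjoint = disj }
    where
    cov : Covering G
    cov φ with covering φ
    ... | C , C∈F , fC with C ≟ᶜ C₁ | C ≟ᶜ C₂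
    ... | no ne₁ | no ne₂ = C , old C∈F ne₁ ne₂ , fC
    ... | no _ | yes refl = D₂ , D₂∈G , falsifies-ext ext-D₂ (falsifies-E ext-C₂ fC) (falsifies₁ (fC y y∈C₂))
    ... | yes refl | _ with value φ y in e
    ... | false = D₂ , D₂∈G , falsifies-ext ext-D₂ (falsifies-E ext-C₁ fC) (falsifies₁ e)
    ... | true  = D₁ , D₁∈G , falsifies-ext ext-D₁ (falsifies-E ext-C₁ fC) (falsifies₂ (fC x x∈C₁) (neg-false y≢0 e))
    old-D₁ : ∀ {φ C} → C ∈ F × C ≢ C₁ × C ≢ C₂ → Falsifies φ C → ¬ Falsifies φ D₁
    old-D₁ {φ} (C∈F , ne₁ , _) fC fD = ne₁ (disjoint φ C∈F C₁∈F fC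
      (falsifies-ext ext-C₁ (falsifies-E ext-D₁ fD) (falsifies₁ (fD x x∈D₁))))
    old-D₂ : ∀ {φ C} → C ∈ F × C ≢ C₁ × C ≢ C₂ → Falsifies φ C → ¬ Falsifies φ D₂
    old-D₂ {φ} (C∈F , ne₁ , ne₂) fC fD with value φ x in e
    ... | false = ne₁ (disjoint φ C∈F C₁∈F fC (falsifies-ext ext-C₁ (falsifies-E ext-D₂ fD) (falsifies₁ e)))
    ... | true  = ne₂ (disjoint φ C∈F C₂∈F fC (falsifies-ext ext-C₂ (falsifies-E ext-D₂ fD)
                    (falsifies₂ (neg-false x≢0 e) (fD y y∈D₂))))
    D₁-D₂ : ∀ {φ} → Falsifies φ D₁ → ¬ Falsifies φ D₂
    D₁-D₂ {φ} f₁ f₂ = contradiction (trans (sym (f₂ y y∈D₂)) (value-neg-true φ y≢0 (f₁ (- y) -y∈D₁))) λ ()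
    disj : ∀ φ {C D} → C ∈ G → D ∈ G → Falsifies φ C → Falsifies φ D → C ≡ D
    disj φ C∈ D∈ fC fD with G⁻ C∈ | G⁻ D∈
    ... | inj₁ c             | inj₁ d             = disjoint φ (proj₁ c) (proj₁ d) fC fD
    ... | inj₁ c             | inj₂ (inj₁ refl)   = contradiction fD (old-D₁ c fC)
    ... | inj₁ c             | inj₂ (inj₂ refl)   = contradiction fD (old-D₂ c fC)
    ... | inj₂ (inj₁ refl)   | inj₁ d             = contradiction fC (old-D₁ d fD)
    ... | inj₂ (inj₂ refl)   | inj₁ d             = contradiction fC (old-D₂ d fD)
    ... | inj₂ (inj₁ refl)   | inj₂ (inj₁ refl)   = refl
    ... | inj₂ (inj₁ refl)   | inj₂ (inj₂ refl)   = contradiction fD (D₁-D₂ fC)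
    ... | inj₂ (inj₂ refl)   | inj₂ (inj₁ refl)   = contradiction fC (D₁-D₂ fD)
    ... | inj₂ (inj₂ refl)   | inj₂ (inj₂ refl)   = refl

  flip-cc : cc G ≡ cc F
  flip-cc = trans (unique-≐⇒length≡ (proj₂ wf-G) (unique₂ D₁∉ D₂∉ D₁≢D₂) G⊆ ⊆G)
                  (sym (unique-≐⇒length≡ unique (unique₂ C₁∉ C₂∉ C₁≢C₂) F⊆ ⊆F))
    where
    rest? : Decidable (λ C → C ≢ C₁ × C ≢ C₂)
    rest? C = ¬? (C ≟ᶜ C₁) ×-dec ¬? (C ≟ᶜ C₂)
    rest = filter rest? F
    rest⁻ : ∀ {C} → C ∈ rest → C ∈ F × C ≢ C₁ × C ≢ C₂
    rest⁻ = ∈-filter⁻ rest? {xs = F}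
    unique₂ : ∀ {A B} → A ∉ rest → B ∉ rest → A ≢ B → Unique (A ∷ B ∷ rest)
    unique₂ A∉ B∉ A≢B = ∉⇒unique-∷ A∉′ (∉⇒unique-∷ B∉ (Uniqueₚ.filter⁺ rest? unique))
      where
      A∉′ : _ ∉ _ ∷ rest
      A∉′ (here e)  = A≢B e
      A∉′ (there p) = A∉ p
    C₁∉ : C₁ ∉ rest
    C₁∉ p = proj₁ (proj₂ (rest⁻ p)) refl
    C₂∉ : C₂ ∉ rest
    C₂∉ p = proj₂ (proj₂ (rest⁻ p)) refl
    D₁∉ : D₁ ∉ rest
    D₁∉ p = D₁∉F (proj₁ (rest⁻ p))
    D₂∉ : D₂ ∉ rest
    D₂∉ p = D₂∉F (proj₁ (rest⁻ p))
    G⊆ : ∀ {C} → C ∈ G → C ∈ D₁ ∷ D₂ ∷ rest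
    G⊆ C∈ with G⁻ C∈
    ... | inj₁ (C∈F , ne)  = there (there (∈-filter⁺ rest? C∈F ne))
    ... | inj₂ (inj₁ refl) = here refl
    ... | inj₂ (inj₂ refl) = there (here refl)
    ⊆G : ∀ {C} → C ∈ D₁ ∷ D₂ ∷ rest → C ∈ G
    ⊆G (here refl)         = D₁∈G
    ⊆G (there (here refl)) = D₂∈G
    ⊆G (there (there p))   = let C∈F , ne₁ , ne₂ = rest⁻ p in old C∈F ne₁ ne₂
    F⊆ : ∀ {C} → C ∈ F → C ∈ C₁ ∷ C₂ ∷ rest
    F⊆ {C} C∈F with C ≟ᶜ C₁ | C ≟ᶜ C₂
    ... | yes e | _      = here e
    ... | no _  | yes e  = there (here e)
    ... | no n₁ | no n₂  = there (there (∈-filter⁺ rest? C∈F (n₁ , n₂)))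
    ⊆F : ∀ {C} → C ∈ C₁ ∷ C₂ ∷ rest → C ∈ F
    ⊆F (here refl)         = C₁∈F
    ⊆F (there (here refl)) = C₂∈F
    ⊆F (there (there p))   = proj₁ (rest⁻ p)

  private
    occurs : ∀ {C z} → C ∈ G → z ∈ C → ∃ λ D → D ∈ F × z ∈ D
    occurs {C} C∈G z∈C with G⁻ C∈G
    ... | inj₁ (C∈F , _) = C , C∈F , z∈C
    ... | inj₂ (inj₁ refl) with ext⁻ ext-D₁ z∈C
    ...   | inj₁ z∈E                 = C₁ , C₁∈F , ∈E⇒ ext-C₁ z∈E
    ...   | inj₂ (here refl)         = C₁ , C₁∈F , x∈C₁
    -- `- y` is new in `D₁`, but it occurs in `F` because `y` does.
    ...   | inj₂ (there (here refl)) = occurs-neg U C₂∈F y∈C₂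
    occurs {C} C∈G z∈C | inj₂ (inj₂ refl) with ext⁻ ext-D₂ z∈C
    ...   | inj₁ z∈E         = C₁ , C₁∈F , ∈E⇒ ext-C₁ z∈E
    ...   | inj₂ (here refl) = C₂ , C₂∈F , y∈C₂

  flip-nv : nv G ≡ nv F
  flip-nv = unique-≐⇒length≡ (vars-unique G) (vars-unique F) to from
    where
    to : ∀ {v} → v ∈ vars G → v ∈ vars F
    to v∈ with ∈-vars⁻ G v∈
    ... | C , z , C∈G , z∈C , refl = let D , D∈F , z∈D = occurs C∈G z∈C in ∈-vars⁺ D∈F z∈D
    from : ∀ {v} → v ∈ vars F → v ∈ vars G
    from v∈ with ∈-vars⁻ F v∈
    ... | C , z , C∈F , z∈C , refl with C ≟ᶜ C₁ | C ≟ᶜ C₂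
    ... | no ne₁ | no ne₂ = ∈-vars⁺ (old C∈F ne₁ ne₂) z∈C
    ... | yes refl | _ with ext⁻ ext-C₁ z∈C
    ...   | inj₁ z∈E         = ∈-vars⁺ D₁∈G (∈E⇒ ext-D₁ z∈E)
    ...   | inj₂ (here refl) = ∈-vars⁺ D₁∈G x∈D₁
    from v∈ | C , z , C∈F , z∈C , refl | no _ | yes refl with ext⁻ ext-C₂ z∈C
    ...   | inj₁ z∈E                 = ∈-vars⁺ D₁∈G (∈E⇒ ext-D₁ z∈E)
    ...   | inj₂ (here refl)         = subst (_∈ vars G) (sym (ℤₚ.∣-i∣≡∣i∣ x)) (∈-vars⁺ D₁∈G x∈D₁)
    ...   | inj₂ (there (here refl)) = ∈-vars⁺ D₂∈G y∈D₂

  module _ (ns : NoOnce F) where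

    private
      -- `D₁` contains `C₁`, and `D₂` is `C₂` without `- x`; so this replacement loses no occurrence
      -- except one of `- x`.
      image : ∀ {C z} → C ∈ F → z ∈ C → z ≢ - x → ∃ λ D → D ∈ G × z ∈ D ×
        ((C ≡ C₁ × D ≡ D₁) ⊎ (C ≡ C₂ × D ≡ D₂) ⊎ (C ∈ F × D ≡ C))
      image {C} C∈F z∈C z≢-x with C ≟ᶜ C₁ | C ≟ᶜ C₂
      ... | no ne₁ | no ne₂ = C , old C∈F ne₁ ne₂ , z∈C , inj₂ (inj₂ (C∈F , refl))
      ... | yes refl | _ = D₁ , D₁∈G , ext⁺ ext-D₁ ([ inj₁ , (λ where (here e) → inj₂ (here e)) ]′ (ext⁻ ext-C₁ z∈C))
                         , inj₁ (refl , refl)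
      ... | no _ | yes refl = D₂ , D₂∈G , ext⁺ ext-D₂ ([ inj₁ , (λ where
                                  (here e) → contradiction e z≢-x
                                  (there (here e)) → inj₂ (here e)) ]′ (ext⁻ ext-C₂ z∈C))
                            , inj₂ (inj₁ (refl , refl))

      image-injective : ∀ {C C′ D D′} →
        (C ≡ C₁ × D ≡ D₁) ⊎ (C ≡ C₂ × D ≡ D₂) ⊎ (C ∈ F × D ≡ C) →
        (C′ ≡ C₁ × D′ ≡ D₁) ⊎ (C′ ≡ C₂ × D′ ≡ D₂) ⊎ (C′ ∈ F × D′ ≡ C′) → D ≡ D′ → C ≡ C′
      image-injective (inj₁ (refl , refl)) (inj₁ (refl , refl)) e = refl
      image-injective (inj₁ (refl , refl)) (inj₂ (inj₁ (refl , refl))) e = contradiction e D₁≢D₂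
      image-injective (inj₁ (refl , refl)) (inj₂ (inj₂ (p , refl))) refl = contradiction p D₁∉F
      image-injective (inj₂ (inj₁ (refl , refl))) (inj₁ (refl , refl)) e = contradiction (sym e) D₁≢D₂
      image-injective (inj₂ (inj₁ (refl , refl))) (inj₂ (inj₁ (refl , refl))) e = refl
      image-injective (inj₂ (inj₁ (refl , refl))) (inj₂ (inj₂ (p , refl))) refl = contradiction p D₂∉F
      image-injective (inj₂ (inj₂ (p , refl))) (inj₁ (refl , refl)) refl = contradiction p D₁∉F
      image-injective (inj₂ (inj₂ (p , refl))) (inj₂ (inj₁ (refl , refl))) refl = contradiction p D₂∉F
      image-injective (inj₂ (inj₂ (p , refl))) (inj₂ (inj₂ (q , refl))) e = e

    -- Two clauses of `F` with `z` have distinct images with `z`; here `D₁` and `D₂` being outside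
    -- `F` excludes collisions.
    flip-once : ∀ z → Once G z → z ≡ - x
    flip-once z (C , C∈G , z∈C , only) with z ℤ.≟ - x
    ... | yes e = e
    ... | no z≢-x =
      let A , A∈F , z∈A = occurs C∈G z∈C
          B , B∈F , z∈B , B≢A = another (ns z) A∈F z∈A
          A′ , A′∈G , z∈A′ , iA = image A∈F z∈A z≢-x
          B′ , B′∈G , z∈B′ , iB = image B∈F z∈B z≢-x
      in contradiction (image-injective iB iA (trans (only B′ B′∈G z∈B′) (sym (only A′ A′∈G z∈A′)))) B≢A

    -- If - x has degree one in G, setting - x true yields a nonsingular set containing the pair
    -- E ∪ {- y}, E ∪ {y}, and y still occurs elsewhere.
    flip-once-bound : ∀ {k} → HasDeficiency G k → (∀ j → 2 ≤ j → j < k → Bound j) → Once G (- x) → nv G + 5 ≤ 4 * k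
    flip-once-bound {k} def bounds once@(C₃ , C₃∈G , -x∈C₃ , only) = result
      where
      open ℕₚ.≤-Reasoning
      UG = flip-uhit
      -x≢0 = neg≢0 x≢0
      R = restrict G (- x)
      UR = restrict-uhit -x≢0 UG
      nvG = once-nv UG once
      defR : HasDeficiency R k
      defR = ℕₚ.suc-injective (trans (sym (once-cc UG once)) (trans def (cong (_+ k) nvG)))
      -- `- - x` equals `x` only propositionally, hence the transports along `neg-involutive`.
      rem = remove (- - x)
      rem-inj : ∀ {C D} → C ∈ G → D ∈ G → - x ∉ C → - x ∉ D → rem C ≡ rem D → C ≡ D
      rem-inj = remove-injective -x≢0 UG
      ∣y∣⇒≢x″ : ∀ {z} → ∣ z ∣ ≡ ∣ y ∣ → z ≢ - - x
      ∣y∣⇒≢x″ e z≡ = ∣x∣≢∣y∣ (trans (cong ∣_∣ (sym (trans z≡ (ℤₚ.neg-involutive x)))) e)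
      ∈E⇒≢x″ : ∀ {z} → z ∈ E → z ≢ - - x
      ∈E⇒≢x″ z∈E z≡ = x∉E (subst (_∈ E) (trans z≡ (ℤₚ.neg-involutive x)) z∈E)
      twice : ∀ {C D z} → C ∈ G → D ∈ G → - x ∉ C → - x ∉ D → C ≢ D → z ∈ C → z ∈ D → z ≢ - - x → ¬ Once R z
      twice C∈G D∈G x∉C x∉D C≢D z∈C z∈D z≢ (_ , _ , _ , onlyR) = C≢D (rem-inj C∈G D∈G x∉C x∉D (trans
        (onlyR _ (∈-restrict⁺ C∈G x∉C) (∈-remove⁺ z∈C z≢)) (sym (onlyR _ (∈-restrict⁺ D∈G x∉D) (∈-remove⁺ z∈D z≢)))))
      x″∈D₁ : - - x ∈ D₁
      x″∈D₁ = subst (_∈ D₁) (sym (ℤₚ.neg-involutive x)) x∈D₁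
      -- At least two clauses of `F` contain `- y`, so one of them is not the clause `C₃` that the
      -- restriction drops.
      -y-clause : ∃ λ P → P ∈ F × - y ∈ P × P ≢ C₃
      -y-clause with occurs-neg U C₂∈F y∈C₂
      ... | P , P∈F , -y∈P with P ≟ᶜ C₃
      ... | no P≢C₃ = P , P∈F , -y∈P , P≢C₃
      ... | yes refl = another (ns (- y)) P∈F -y∈P
      -- By `once-restrict` a degree-one literal of `R` would come from the only clause with `x`,
      -- which is `D₁`. Literals of `E` recur in `D₂`, and `- y` recurs in `P`.
      nsR : NoOnce R
      nsR z onceR@(_ , D∈R , z∈D , _) with restrict-∌ {G} D∈R z∈D | once-restrict UG once onceR
      ... | z≢-x , _ | inj₁ onceG = z≢-x (flip-once z onceG)
      ... | _ , z≢x″ | inj₂ (D , z∈D , D∈G , x″∈D , onlyD)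
        with ext⁻ ext-D₁ (subst (z ∈_) (sym (onlyD D₁ D₁∈G x″∈D₁)) z∈D)
      ... | inj₁ z∈E = twice D₁∈G D₂∈G -x∉D₁ -x∉D₂ D₁≢D₂ (∈E⇒ ext-D₁ z∈E) (∈E⇒ ext-D₂ z∈E) z≢x″ onceR
      ... | inj₂ (here e) = z≢x″ (trans e (sym (ℤₚ.neg-involutive x)))
      ... | inj₂ (there (here refl)) =
            let P , P∈F , -y∈P , P≢C₃ = -y-clause
                P∈G = old P∈F (λ e → -y∉C₁ (subst (- y ∈_) e -y∈P)) (λ e → -y∉C₂ (subst (- y ∈_) e -y∈P))
            in twice P∈G D₁∈G (P≢C₃ ∘ only P P∈G) -x∉D₁ (λ e → D₁∉F (subst (_∈ F) e P∈F)) -y∈P -y∈D₁ z≢x″ onceR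
      F′ = rem D₁ ∷ rem D₂ ∷ []
      F′! : Unique F′
      F′! = (D₁≢D₂ ∘ rem-inj D₁∈G D₂∈G -x∉D₁ -x∉D₂ ∷ []) ∷ [] ∷ []
      F′⊆R : ∀ {C} → C ∈ F′ → C ∈ R
      F′⊆R (here refl)         = ∈-restrict⁺ D₁∈G -x∉D₁
      F′⊆R (there (here refl)) = ∈-restrict⁺ D₂∈G -x∉D₂
      E-inAll : ∀ {z} → z ∈ E → All (z ∈_) F′
      E-inAll z∈E = ∈-remove⁺ (∈E⇒ ext-D₁ z∈E) (∈E⇒≢x″ z∈E) ∷ ∈-remove⁺ (∈E⇒ ext-D₂ z∈E) (∈E⇒≢x″ z∈E) ∷ []
      core-covering : Covering (core F′)
      core-covering φ with value φ y in e
      ... | true = _ , here refl , λ z z∈ →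
              let z∈rem , ¬all = ∈-filter⁻ (λ z → ¬? (inAll? F′ z)) {xs = rem D₁} z∈
                  z∈D₁ , z≢x″ = ∈-remove⁻ D₁ z∈rem
              in [ (λ z∈E → contradiction (E-inAll z∈E) ¬all)
                 , (λ where (here z≡x) → contradiction (trans z≡x (sym (ℤₚ.neg-involutive x))) z≢x″
                            (there (here refl)) → neg-false y≢0 e) ]′ (ext⁻ ext-D₁ z∈D₁)
      ... | false = _ , there (here refl) , λ z z∈ →
              let z∈rem , ¬all = ∈-filter⁻ (λ z → ¬? (inAll? F′ z)) {xs = rem D₂} z∈
              in [ (λ z∈E → contradiction (E-inAll z∈E) ¬all)
                 , (λ where (here refl) → e) ]′ (ext⁻ ext-D₂ (proj₁ (∈-remove⁻ D₂ z∈rem)))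
      result : nv G + 5 ≤ 4 * k
      result with another (ns y) C₂∈F y∈C₂
      ... | P , P∈F , y∈P , P≢C₂ = begin
          nv G + 5                                ≡⟨ cong (_+ 5) (trans nvG (ℕₚ.+-comm 1 (nv R))) ⟩
          -- The shared variable of `y` pays for the variable lost in the restriction.
          nv R + 1 + 5                            ≤⟨ ℕₚ.+-monoˡ-≤ 5 (ℕₚ.+-monoʳ-≤ (nv R) shared≥1) ⟩
          nv R + length Fac.shared + 5            ≤⟨ Fac.factor-bound defR bounds ⟩
          4 * k                                   ∎
        where
        P∈G = old P∈F (λ e → y∉C₁ (subst (y ∈_) e y∈P)) P≢C₂
        -- Otherwise `P` is the only clause with `- x`, and `only-clause-⊆` puts its literal `y`
        -- into `D₁`, which contains `- y`.
        -x∉P : - x ∉ P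
        -x∉P -x∈P with only P P∈G -x∈P
        ... | refl = y∉D₁ (only-clause-⊆ UG C₃∈G -x∈C₃ only D₁∈G x″∈D₁ y∈P λ y≡-x → ∣-x∣≢∣y∣ (cong ∣_∣ (sym y≡-x)))
        P∈R : rem P ∈ R
        P∈R = ∈-restrict⁺ P∈G -x∉P
        P∉F′ : rem P ∉ F′
        P∉F′ (here e)         = D₁∉F (subst (_∈ F) (rem-inj P∈G D₁∈G -x∉P -x∉D₁ e) P∈F)
        P∉F′ (there (here e)) = D₂∉F (subst (_∈ F) (rem-inj P∈G D₂∈G -x∉P -x∉D₂ e) P∈F)
        module Fac = Factor UR nsR F′! F′⊆R core-covering ℕₚ.≤-refl P∈R P∉F′
        shared≥1 : 1 ≤ length Fac.shared
        shared≥1 = Fac.shared-nonempty {C = rem D₂} {rem D₁} {rem P} {y}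
          (there (here refl)) (∈-remove⁺ y∈D₂ (∣y∣⇒≢x″ refl)) (here refl) (y∉D₁ ∘ proj₁ ∘ ∈-remove⁻ D₁)
          P∈R P∉F′ (∈-remove⁺ y∈P (∣y∣⇒≢x″ refl))

-- Counterexamples to the bound, and their flips

module _ {k : ℕ} (bounds : ∀ j → 2 ≤ j → j < k → Bound j) where

  Counterexample : ClauseSet → Set
  Counterexample F = UHit F × NoOnce F × HasDeficiency F k × ¬ nv F + 5 ≤ 4 * k

  -- Only `- x` can become a literal of degree one, and then `flip-once-bound` contradicts the
  -- unchanged number of variables.
  flip-counterexample : ∀ {F G} → Counterexample F → NfsFlip F G → Counterexample G
  flip-counterexample {F} {G} (U , ns , def , big)
    (E , x , y , C₁ , C₂ , D₁ , D₂ , _ , x≢0 , y≢0 , ∣x∣≢∣y∣ , x∉E , -x∉E , y∉E , -y∉E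
      , ext-C₁ , ext-C₂ , ext-D₁ , ext-D₂ , C₁∈F , C₂∈F , D₁∉F , D₂∉F , wf-G , G⇔)
    = Fl.flip-uhit , nsG , defG , bigG
    where
    module Fl = Flip U x≢0 y≢0 ∣x∣≢∣y∣ x∉E -x∉E y∉E -y∉E ext-C₁ ext-C₂ ext-D₁ ext-D₂ C₁∈F C₂∈F D₁∉F D₂∉F wf-G G⇔
    defG : HasDeficiency G k
    defG = trans Fl.flip-cc (trans def (cong (_+ k) (sym Fl.flip-nv)))
    bigG : ¬ nv G + 5 ≤ 4 * k
    bigG = big ∘ subst (λ n → n + 5 ≤ 4 * k) Fl.flip-nv
    nsG : NoOnce G
    nsG z once = bigG (Fl.flip-once-bound ns defG bounds (subst (Once G) (Fl.flip-once ns z once) once))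

  star-counterexample : ∀ {F G} → Counterexample F → Star NfsFlip F G → Counterexample G
  star-counterexample cx ε        = cx
  star-counterexample cx (f ◅ fs) = star-counterexample (flip-counterexample cx f) fs

  -- Every clause-set reached by flips is again a counterexample, and `reducible-bound` denies it
  -- any nontrivial factor.
  counterexample-nfsIrreducible : ∀ {F} → Counterexample F → NfsIrreducible F
  counterexample-nfsIrreducible {F} cx@(U , ns , def , big) =
      irreducible , unsat , uhit-hitting U , λ G flips → λ where
        (F′ , F′⊆G , factor , ¬trivial) → let UG , nsG , defG , bigG = star-counterexample cx flips in
          bigG (reducible-bound UG nsG defG bounds F′⊆G factor ¬trivial)
    where
    unsat = covering⇒unsat (UHit.covering U)
    irreducible : ClauseIrreducible F
    irreducible F′ F′⊆F factor with length F′ ℕ.≟ 1 | ≡-dec _≟ᶜ_ F′ F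
    ... | yes one | _ = inj₁ one
    ... | no _ | yes refl = inj₂ (unsat , refl)
    ... | no ¬one | no F′≢F = contradiction
          (reducible-bound U ns def bounds F′⊆F factor [ ¬one , F′≢F ∘ proj₂ ]′) big

-- Nonsingular unsatisfiable hitting clause-sets with 4k − 5 variables

Clash : Clause → Clause → Set
Clash C D = ∃ λ x → x ∈ C × - x ∈ D

-- The variables are exactly `1` to `n`, so numbers above `n` are fresh for the next copy. Pairwise
-- clashing yields both `Hitting` and `Unique`.
record Example (n k : ℕ) (F : ClauseSet) : Set where
  field
    wf       : All WfClause F
    clashing : AllPairs Clash F
    covering : Covering F
    noOnce   : NoOnce F
    bounded  : ∀ {C z} → C ∈ F → z ∈ C → 1 ≤ ∣ z ∣ × ∣ z ∣ ≤ n
    occurs   : ∀ {v} → 1 ≤ v → v ≤ n → v ∈ vars F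
    clauses  : cc F ≡ n + k

clash-sym : ∀ {C D} → Clash C D → Clash D C
clash-sym {C} (x , x∈C , -x∈D) = - x , -x∈D , subst (_∈ C) (sym (ℤₚ.neg-involutive x)) x∈C

clashing⇒hitting : ∀ {F} → AllPairs Clash F → Hitting F
clashing⇒hitting (_ ∷ _)  C D (here refl) (here refl) C≢D = contradiction refl C≢D
clashing⇒hitting (cl ∷ _) C D (here refl) (there D∈)  C≢D = All.lookup cl D∈
clashing⇒hitting (cl ∷ _) C D (there C∈)  (here refl) C≢D = clash-sym (All.lookup cl C∈)
clashing⇒hitting (_ ∷ cs) C D (there C∈)  (there D∈)  C≢D = clashing⇒hitting cs C D C∈ D∈ C≢D

clashing⇒unique : ∀ {F} → All WfClause F → AllPairs Clash F → Unique F
clashing⇒unique []                 []        = []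
clashing⇒unique ((_ , _ , con) ∷ wf) (cl ∷ cs) =
  All.map (λ where (x , x∈C , -x∈D) refl → con x x∈C -x∈D) cl ∷ clashing⇒unique wf cs

example-nv : ∀ {n k F} → Example n k F → nv F ≡ n
example-nv {n} {k} {F} ex = trans
  (unique-≐⇒length≡ (vars-unique F) (Uniqueₚ.map⁺ ℕₚ.suc-injective (Uniqueₚ.upTo⁺ n)) to from)
  (trans (length-map suc (upTo n)) (length-upTo n))
  where
  open Example ex
  to : ∀ {v} → v ∈ vars F → v ∈ map suc (upTo n)
  to v∈ with ∈-vars⁻ F v∈
  ... | C , z , C∈F , z∈C , refl with ∣ z ∣ | bounded C∈F z∈C
  ... | suc v | _ , v<n = ∈-map⁺ suc (∈-upTo⁺ v<n)
  from : ∀ {v} → v ∈ map suc (upTo n) → v ∈ vars F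
  from v∈ with ∈-map⁻ suc v∈
  ... | v , v∈ , refl = occurs (s≤s z≤n) (∈-upTo⁻ v∈)

example-nsuhit : ∀ {n k F} → Example n k F → NSUHIT k F
example-nsuhit {n} {k} {F} ex = (wf , clashing⇒unique wf clashing) , noOnce⇒nonsingular noOnce
  , covering⇒unsat covering , clashing⇒hitting clashing , trans clauses (cong (_+ k) (sym (example-nv ex)))
  where open Example ex

module Cycle (m : ℕ) where

  p q r p̄ q̄ r̄ : Lit
  p = ℤ.+ (1 + m)
  q = ℤ.+ (2 + m)
  r = ℤ.+ (3 + m)
  p̄ = ℤ.-[1+ m ]
  q̄ = ℤ.-[1+ 1 + m ]
  r̄ = ℤ.-[1+ 2 + m ]

  -- On the cube, the clauses of length three take the two constant points. The other six points
  -- form a hexagon, and the three short clauses take alternate edges of it.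
  cycle : ClauseSet
  cycle = (p ∷ q ∷ r ∷ []) ∷ (r̄ ∷ q̄ ∷ p̄ ∷ []) ∷ (q̄ ∷ p ∷ []) ∷ (r̄ ∷ q ∷ []) ∷ (p̄ ∷ r ∷ []) ∷ []

  private
    pattern 1st = here refl
    pattern 2nd = there (here refl)
    pattern 3rd = there (there (here refl))
    pattern 4th = there (there (there (here refl)))
    pattern 5th = there (there (there (there (here refl))))

    p<q : 1 + m < 2 + m
    p<q = ℕₚ.n<1+n _
    q<r : 2 + m < 3 + m
    q<r = ℕₚ.n<1+n _
    p<r : 1 + m < 3 + m
    p<r = ℕₚ.<-trans p<q q<r

  cycle-wf : All WfClause cycle
  cycle-wf =
      ( (ℤ.+<+ p<q ∷ ℤ.+<+ p<r ∷ []) ∷ (ℤ.+<+ q<r ∷ []) ∷ [] ∷ [] , (λ ()) ∷ (λ ()) ∷ (λ ()) ∷ []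
      , λ where _ 1st (there (there (there ())))
                _ 2nd (there (there (there ())))
                _ 3rd (there (there (there ()))) )
    ∷ ( (ℤ.-<- (ℕ.s≤s⁻¹ q<r) ∷ ℤ.-<- (ℕ.s≤s⁻¹ p<r) ∷ []) ∷ (ℤ.-<- (ℕ.s≤s⁻¹ p<q) ∷ []) ∷ [] ∷ [] , (λ ()) ∷ (λ ()) ∷ (λ ()) ∷ []
      , λ where _ 1st (there (there (there ())))
                _ 2nd (there (there (there ())))
                _ 3rd (there (there (there ()))) )
    ∷ ( (ℤ.-<+ ∷ []) ∷ [] ∷ [] , (λ ()) ∷ (λ ()) ∷ []
      , λ where _ 1st (there (there ()))
                _ 2nd (there (there ())) )
    ∷ ( (ℤ.-<+ ∷ []) ∷ [] ∷ [] , (λ ()) ∷ (λ ()) ∷ []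
      , λ where _ 1st (there (there ()))
                _ 2nd (there (there ())) )
    ∷ ( (ℤ.-<+ ∷ []) ∷ [] ∷ [] , (λ ()) ∷ (λ ()) ∷ []
      , λ where _ 1st (there (there ()))
                _ 2nd (there (there ())) )
    ∷ []

  cycle-clashing : AllPairs Clash cycle
  cycle-clashing =
      ((p , 1st , 3rd) ∷ (q , 2nd , 1st) ∷ (r , 3rd , 1st) ∷ (p , 1st , 1st) ∷ [])
    ∷ ((p̄ , 3rd , 2nd) ∷ (q̄ , 2nd , 2nd) ∷ (r̄ , 1st , 2nd) ∷ [])
    ∷ ((q̄ , 1st , 2nd) ∷ (p , 2nd , 1st) ∷ [])
    ∷ ((r̄ , 1st , 2nd) ∷ [])
    ∷ [] ∷ []

  cycle-covering : Covering cycle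
  cycle-covering φ with φ (1 + m) in ep | φ (2 + m) in eq | φ (3 + m) in er
  ... | true  | _     | false = _ , 5th , λ where _ 1st → cong not ep
                                                  _ 2nd → er
  ... | true  | false | true  = _ , 4th , λ where _ 1st → cong not er
                                                  _ 2nd → eq
  ... | true  | true  | true  = _ , 2nd , λ where _ 1st → cong not er
                                                  _ 2nd → cong not eq
                                                  _ 3rd → cong not ep
  ... | false | true  | _     = _ , 3rd , λ where _ 1st → cong not eq
                                                  _ 2nd → ep
  ... | false | false | true  = _ , 4th , λ where _ 1st → cong not er
                                                  _ 2nd → eq
  ... | false | false | false = _ , 1st , λ where _ 1st → ep
                                                  _ 2nd → eq
                                                  _ 3rd → er

  cycle-noOnce : NoOnce cycle
  cycle-noOnce z (_ , C∈ , z∈C , only) = go C∈ z∈C only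
    where
    go : ∀ {z C} → C ∈ cycle → z ∈ C → ¬ (∀ D → D ∈ cycle → z ∈ D → D ≡ C)
    -- Every literal lies in one clause of length three and one of length two, so lengths tell the
    -- two apart.
    go 1st 1st only = contradiction (cong length (only (q̄ ∷ p ∷ []) 3rd 2nd)) λ ()
    go 1st 2nd only = contradiction (cong length (only (r̄ ∷ q ∷ []) 4th 2nd)) λ ()
    go 1st 3rd only = contradiction (cong length (only (p̄ ∷ r ∷ []) 5th 2nd)) λ ()
    go 2nd 1st only = contradiction (cong length (only (r̄ ∷ q ∷ []) 4th 1st)) λ ()
    go 2nd 2nd only = contradiction (cong length (only (q̄ ∷ p ∷ []) 3rd 1st)) λ ()
    go 2nd 3rd only = contradiction (cong length (only (p̄ ∷ r ∷ []) 5th 1st)) λ ()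
    go 3rd 1st only = contradiction (cong length (only (r̄ ∷ q̄ ∷ p̄ ∷ []) 2nd 2nd)) λ ()
    go 3rd 2nd only = contradiction (cong length (only (p ∷ q ∷ r ∷ []) 1st 1st)) λ ()
    go 4th 1st only = contradiction (cong length (only (r̄ ∷ q̄ ∷ p̄ ∷ []) 2nd 1st)) λ ()
    go 4th 2nd only = contradiction (cong length (only (p ∷ q ∷ r ∷ []) 1st 2nd)) λ ()
    go 5th 1st only = contradiction (cong length (only (r̄ ∷ q̄ ∷ p̄ ∷ []) 2nd 3rd)) λ ()
    go 5th 2nd only = contradiction (cong length (only (p ∷ q ∷ r ∷ []) 1st 3rd)) λ ()

  cycle-bounded : ∀ {C z} → C ∈ cycle → z ∈ C → 1 ≤ ∣ z ∣ × ∣ z ∣ ≤ 3 + m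
  cycle-bounded C∈ z∈C = All.lookup (All.lookup bounds C∈) z∈C
    where
    P : Lit → Set
    P z = 1 ≤ ∣ z ∣ × ∣ z ∣ ≤ 3 + m
    p≤ : 1 ≤ 1 + m × 1 + m ≤ 3 + m
    p≤ = s≤s z≤n , ℕₚ.<⇒≤ p<r
    q≤ : 1 ≤ 2 + m × 2 + m ≤ 3 + m
    q≤ = s≤s z≤n , ℕₚ.<⇒≤ q<r
    r≤ : 1 ≤ 3 + m × 3 + m ≤ 3 + m
    r≤ = s≤s z≤n , ℕₚ.≤-refl
    bounds : All (All P) cycle
    bounds = (p≤ ∷ q≤ ∷ r≤ ∷ []) ∷ (r≤ ∷ q≤ ∷ p≤ ∷ []) ∷ (q≤ ∷ p≤ ∷ []) ∷ (r≤ ∷ q≤ ∷ []) ∷ (p≤ ∷ r≤ ∷ []) ∷ []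

  cycle-occurs : ∀ {v} → m < v → v ≤ 3 + m → ∃ λ z → z ∈ p ∷ q ∷ r ∷ [] × v ≡ ∣ z ∣
  cycle-occurs {v} m<v v≤ with v ℕ.≟ 1 + m | v ℕ.≟ 2 + m | v ℕ.≟ 3 + m
  ... | yes e | _ | _ = p , 1st , e
  ... | no _ | yes e | _ = q , 2nd , e
  ... | no _ | no _ | yes e = r , 3rd , e
  ... | no ne₁ | no ne₂ | no ne₃ = contradiction v≤ (ℕₚ.<⇒≱
          (ℕₚ.≤∧≢⇒< (ℕₚ.≤∧≢⇒< (ℕₚ.≤∧≢⇒< m<v (ne₁ ∘ sym)) (ne₂ ∘ sym)) (ne₃ ∘ sym)))

cycle-example : Example 3 2 (Cycle.cycle 0)
cycle-example = record
  { wf = cycle-wf ; clashing = cycle-clashing ; covering = cycle-covering ; noOnce = cycle-noOnce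
  ; bounded = cycle-bounded ; clauses = refl
  ; occurs = λ v≥1 v≤3 → let z , z∈ , e = cycle-occurs v≥1 v≤3 in
               subst (_∈ vars cycle) (sym e) (∈-vars⁺ {cycle} {x = z} (here refl) z∈) }
  where open Cycle 0

module Extend {m k F} (ex : Example m k F) (k≥2 : 2 ≤ k) where
  open Example ex
  open Cycle m

  a : ℕ
  a = 3 + m

  -- The new variable exceeds all others: its positive literal belongs at the end of a sorted clause
  -- and its negative literal at the front.
  snoc cons : Clause → Clause
  snoc C = C ++ (ℤ.+ suc a ∷ [])
  cons C = ℤ.-[1+ a ] ∷ C

  -- Setting the new variable to false leaves the cycle, to true leaves `F`. Five clauses and four
  -- variables are added, so the deficiency grows by one.
  extend : ClauseSet
  extend = map snoc cycle ++ map cons F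

  Below : Clause → Set
  Below C = ∀ {z} → z ∈ C → ∣ z ∣ ≤ a

  private
    below-cycle : ∀ {C} → C ∈ cycle → Below C
    below-cycle C∈ z∈C = proj₂ (cycle-bounded C∈ z∈C)

    below-F : ∀ {C} → C ∈ F → Below C
    below-F C∈ z∈C = ℕₚ.≤-trans (proj₂ (bounded C∈ z∈C)) (ℕₚ.m≤n+m m 3)

    <a : ∀ z → ∣ z ∣ ≤ a → z ℤ.< ℤ.+ suc a
    <a (ℤ.+ n)      le = ℤ.+<+ (s≤s le)
    <a ℤ.-[1+ n ]   le = ℤ.-<+

    -a< : ∀ z → ∣ z ∣ ≤ a → ℤ.-[1+ a ] ℤ.< z
    -a< (ℤ.+ n)    le = ℤ.-<+
    -a< ℤ.-[1+ n ] le = ℤ.-<- le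

    fresh : ∀ {C z} → Below C → ∣ z ∣ ≡ suc a → z ∉ C
    fresh below e z∈C = ℕₚ.<-irrefl refl (subst (_≤ a) e (below z∈C))

    wf-snoc : ∀ {C} → Below C → WfClause C → WfClause (snoc C)
    wf-snoc {C} below (C↗ , ≢0 , con) =
        AllPairsₚ.++⁺ C↗ ([] ∷ []) (All.tabulate λ z∈C → <a _ (below z∈C) ∷ [])
      , Allₚ.++⁺ ≢0 ((λ ()) ∷ [])
      , λ x x∈ -x∈ → con′ x (∈-++⁻ C x∈) (∈-++⁻ C -x∈)
      where
      con′ : ∀ x → x ∈ C ⊎ x ∈ ℤ.+ suc a ∷ [] → - x ∈ C ⊎ - x ∈ ℤ.+ suc a ∷ [] → ⊥
      con′ x (inj₁ p) (inj₁ q) = con x p q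
      con′ x (inj₁ p) (inj₂ (here e)) = fresh below (trans (sym (ℤₚ.∣-i∣≡∣i∣ x)) (cong ∣_∣ e)) p
      con′ x (inj₂ (here refl)) (inj₁ q) = fresh below refl q
      con′ x (inj₂ (here refl)) (inj₂ (here ()))

    wf-cons : ∀ {C} → Below C → WfClause C → WfClause (cons C)
    wf-cons {C} below (C↗ , ≢0 , con) =
        All.tabulate (λ z∈C → -a< _ (below z∈C)) ∷ C↗
      , (λ ()) ∷ ≢0
      , con′
      where
      con′ : ∀ x → x ∈ cons C → - x ∉ cons C
      con′ x (here refl) (here ())
      con′ x (here refl) (there q) = fresh below refl q
      con′ x (there p) (here e) = fresh below (trans (sym (ℤₚ.∣-i∣≡∣i∣ x)) (cong ∣_∣ e)) p
      con′ x (there p) (there q) = con x p q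

    snoc∈ : ∀ {C} → C ∈ cycle → snoc C ∈ extend
    snoc∈ C∈ = ∈-++⁺ˡ (∈-map⁺ snoc C∈)

    cons∈ : ∀ {C} → C ∈ F → cons C ∈ extend
    cons∈ C∈ = ∈-++⁺ʳ (map snoc cycle) (∈-map⁺ cons C∈)

    extend⁻ : ∀ {D} → D ∈ extend → (∃ λ C → C ∈ cycle × D ≡ snoc C) ⊎ (∃ λ C → C ∈ F × D ≡ cons C)
    extend⁻ D∈ = [ inj₁ ∘ ∈-map⁻ snoc , inj₂ ∘ ∈-map⁻ cons ]′ (∈-++⁻ (map snoc cycle) D∈)

    a∈snoc : ∀ {C} → ℤ.+ suc a ∈ snoc C
    a∈snoc {C} = ∈-++⁺ʳ C (here refl)

    two-cycle : ∀ C → ∃ λ D → D ∈ cycle × D ≢ C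
    two-cycle C with C ≟ᶜ (p ∷ q ∷ r ∷ [])
    ... | yes refl = q̄ ∷ p ∷ [] , there (there (here refl)) , λ ()
    ... | no ne = _ , here refl , ne ∘ sym

    F-unique : Unique F
    F-unique = clashing⇒unique wf clashing

    two-F : ∀ C → ∃ λ D → D ∈ F × D ≢ C
    two-F C with Any.any? (λ D → ¬? (D ≟ᶜ C)) F
    ... | yes found = find found
    -- With `2 ≤ k` there are at least two clauses in `F`, so the new negative literal does not have
    -- degree one.
    ... | no ¬found = contradiction (ℕₚ.≤-trans (ℕₚ.≤-trans k≥2 (ℕₚ.m≤n+m k m)) (subst (_≤ 1) clauses
            (unique-⊆⇒length≤ {ys = C ∷ []} F-unique all≡C))) λ where (s≤s ())
      where
      all≡C : ∀ {D} → D ∈ F → D ∈ C ∷ []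
      all≡C {D} D∈F with D ≟ᶜ C
      ... | yes e = here e
      ... | no ne = contradiction (lose D∈F ne) ¬found

    extend-covering : Covering extend
    extend-covering φ with φ (suc a) in e
    ... | false = let C , C∈ , fC = cycle-covering φ in snoc C , snoc∈ C∈ , λ z z∈ →
                  [ fC z , (λ where (here refl) → e) ]′ (∈-++⁻ C z∈)
    ... | true  = let C , C∈ , fC = covering φ in cons C , cons∈ C∈ , λ where
                    z (here refl) → cong not e
                    z (there z∈)  → fC z z∈

    extend-noOnce : NoOnce extend
    extend-noOnce z (D , D∈ , z∈D , only) with extend⁻ D∈
    ... | inj₁ (C , C∈ , refl) with ∈-++⁻ C z∈D
    ...   | inj₁ z∈C = let C′ , C′∈ , z∈C′ , ne = another (cycle-noOnce z) C∈ z∈C in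
                       ne (++-cancelʳ _ C′ C (only _ (snoc∈ C′∈) (∈-++⁺ˡ z∈C′)))
    ...   | inj₂ (here refl) = let C′ , C′∈ , ne = two-cycle C in
                               ne (++-cancelʳ _ C′ C (only _ (snoc∈ C′∈) (a∈snoc {C′})))
    extend-noOnce z (D , D∈ , z∈D , only) | inj₂ (C , C∈ , refl) with z∈D
    ...   | here refl = let C′ , C′∈ , ne = two-F C in ne (∷-injectiveʳ (only _ (cons∈ C′∈) (here refl)))
    ...   | there z∈C = let C′ , C′∈ , z∈C′ , ne = another (noOnce z) C∈ z∈C in
                        ne (∷-injectiveʳ (only _ (cons∈ C′∈) (there z∈C′)))

    extend-bounded : ∀ {C z} → C ∈ extend → z ∈ C → 1 ≤ ∣ z ∣ × ∣ z ∣ ≤ suc a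
    extend-bounded {z = z} D∈ z∈D with extend⁻ D∈
    ... | inj₁ (C , C∈ , refl) with ∈-++⁻ C z∈D
    ...   | inj₁ z∈C = proj₁ (cycle-bounded C∈ z∈C) , ℕₚ.m≤n⇒m≤1+n (below-cycle C∈ z∈C)
    ...   | inj₂ (here refl) = s≤s z≤n , ℕₚ.≤-refl
    extend-bounded D∈ z∈D | inj₂ (C , C∈ , refl) with z∈D
    ...   | here refl = s≤s z≤n , ℕₚ.≤-refl
    ...   | there z∈C = proj₁ (bounded C∈ z∈C) , ℕₚ.m≤n⇒m≤1+n (below-F C∈ z∈C)

    extend-occurs : ∀ {v} → 1 ≤ v → v ≤ suc a → v ∈ vars extend
    extend-occurs {v} v≥1 v≤ with v ℕ.≤? m | v ℕ.≤? a
    ... | yes v≤m | _ with ∈-vars⁻ F (occurs v≥1 v≤m)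
    ...   | C , z , C∈ , z∈C , refl = ∈-vars⁺ (cons∈ C∈) (there z∈C)
    extend-occurs {v} v≥1 v≤ | no v≰m | yes v≤a = let z , z∈ , e = cycle-occurs (ℕₚ.≰⇒> v≰m) v≤a in
      subst (_∈ vars extend) (sym e) (∈-vars⁺ {x = z} (snoc∈ (here refl)) (∈-++⁺ˡ z∈))
    extend-occurs {v} v≥1 v≤ | no _ | no v≰a = subst (_∈ vars extend) (ℕₚ.≤-antisym (ℕₚ.≰⇒> v≰a) v≤)
      (∈-vars⁺ {x = ℤ.+ suc a} (snoc∈ (here refl)) (a∈snoc {p ∷ q ∷ r ∷ []}))

    snoc-clashing : AllPairs (λ C D → Clash (snoc C) (snoc D)) cycle
    snoc-clashing = AllPairs.map (λ where (x , x∈ , -x∈) → x , ∈-++⁺ˡ x∈ , ∈-++⁺ˡ -x∈) cycle-clashing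

    cons-clashing : AllPairs (λ C D → Clash (cons C) (cons D)) F
    cons-clashing = AllPairs.map (λ where (x , x∈ , -x∈) → x , there x∈ , there -x∈) clashing

    cross-clashing : All (λ C → All (Clash C) (map cons F)) (map snoc cycle)
    cross-clashing = All.tabulate λ C∈ → All.tabulate λ D∈ → clash (∈-map⁻ snoc C∈) (∈-map⁻ cons D∈)
      where
      clash : ∀ {C D} → (∃ λ C′ → C′ ∈ cycle × C ≡ snoc C′) → (∃ λ D′ → D′ ∈ F × D ≡ cons D′) → Clash C D
      clash (C , _ , refl) (_ , _ , refl) = ℤ.+ suc a , a∈snoc {C} , here refl

  extend-example : Example (4 + m) (suc k) extend
  extend-example = record
    { wf = Allₚ.++⁺ (Allₚ.map⁺ (All.tabulate λ C∈ → wf-snoc (below-cycle C∈) (All.lookup cycle-wf C∈)))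
                    (Allₚ.map⁺ (All.tabulate λ C∈ → wf-cons (below-F C∈) (All.lookup wf C∈)))
    ; clashing = AllPairsₚ.++⁺ (AllPairsₚ.map⁺ snoc-clashing) (AllPairsₚ.map⁺ cons-clashing) cross-clashing
    ; covering = extend-covering ; noOnce = extend-noOnce ; bounded = extend-bounded ; occurs = extend-occurs
    ; clauses = trans (cong (5 +_) (trans (length-map cons F) clauses)) (count m k) }
    where
    count : ∀ m k → 5 + (m + k) ≡ 4 + m + suc k
    count = solve-∀

-- For `k = 2 + j` the count `3 + 4 * j` is `4 * k ∸ 5`.
example : ∀ j → ∃ (Example (3 + 4 * j) (2 + j))
example zero    = _ , cycle-example
example (suc j) = let F , ex = example j in
  Extend.extend ex (s≤s (s≤s z≤n)) , subst (λ n → Example n (3 + j) (Extend.extend ex (s≤s (s≤s z≤n)))) (count j) (Extend.extend-example ex (s≤s (s≤s z≤n)))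
  where
  count : ∀ j → 4 + (3 + 4 * j) ≡ 3 + 4 * suc j
  count = solve-∀

lower-bound : ∀ k → 3 ≤ k → ∀ b → (∀ F → NSUHIT k F → nv F ≤ b) → 4 * k ∸ 5 ≤ b
lower-bound (suc (suc j)) _ b bound = let F , ex = example j in
  subst (_≤ b) (trans (example-nv ex) (sym (trans (cong (_∸ 5) (count j)) (ℕₚ.m+n∸m≡n 5 _)))) (bound F (example-nsuhit ex))
  where
  count : ∀ j → 4 * (2 + j) ≡ 5 + (3 + 4 * j)
  count = solve-∀
lower-bound (suc zero) (s≤s ())

-- The equivalence

bound-from-NEq : ∀ k → 3 ≤ k → NEq k (4 * k ∸ 5) → Bound k
bound-from-NEq k k≥3 (upper , _) {F} U ns def = subst (nv F + 5 ≤_) (ℕₚ.m∸n+n≡m 5≤4k) (ℕₚ.+-monoˡ-≤ 5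
  (upper F ((wf , unique) , noOnce⇒nonsingular ns , covering⇒unsat covering , uhit-hitting U , def)))
  where
  open UHit U
  -- This inequality allows the truncated subtraction to be undone.
  5≤4k : 5 ≤ 4 * k
  5≤4k = ℕₚ.≤-trans (ℕₚ.m≤m+n 5 7) (ℕₚ.*-monoʳ-≤ 4 k≥3)

theorem2 : (k : ℕ) → 3 ≤ k
    → (∀ k' → 3 ≤ k' → k' < k → NEq k' (4 * k' ∸ 5))
    → (NEq k (4 * k ∸ 5)
    ⇔ (∀ F → WfCS F → NfsIrreducible F → HasDeficiency F k → nv F ≤ 4 * k ∸ 5))
theorem2 k k≥3 hyp = mk⇔ to from
  where
  bounds : ∀ j → 2 ≤ j → j < k → Bound j
  bounds j j≥2 j<k with 2 ℕ.≟ j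
  ... | yes refl = bound-2
  ... | no 2≢j = let j≥3 = ℕₚ.≤∧≢⇒< j≥2 2≢j in bound-from-NEq j j≥3 (hyp j j≥3 j<k)

  to : NEq k (4 * k ∸ 5) → ∀ F → WfCS F → NfsIrreducible F → HasDeficiency F k → nv F ≤ 4 * k ∸ 5
  to (upper , _) F wf (irr , unsat , hit , _) def = upper F
    (wf , noOnce⇒nonsingular (irreducible⇒noOnce (uhit wf unsat hit) three irr) , unsat , hit , def)
    where
    -- Three clauses make a factor consisting of two clauses proper.
    three : 3 ≤ cc F
    three = ℕₚ.≤-trans k≥3 (subst (k ≤_) (sym def) (ℕₚ.m≤n+m k (nv F)))

  from : (∀ F → WfCS F → NfsIrreducible F → HasDeficiency F k → nv F ≤ 4 * k ∸ 5) → NEq k (4 * k ∸ 5)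
  from irreducible-bound = upper , lower-bound k k≥3
    where
    upper : ∀ F → NSUHIT k F → nv F ≤ 4 * k ∸ 5
    upper F (wf , ns , unsat , hit , def) with nv F + 5 ℕ.≤? 4 * k
    ... | yes small = ℕₚ.m+n≤o⇒m≤o∸n (nv F) small
    -- A set exceeding the bound would be nfs-irreducible, so the assumption bounds it after all.
    ... | no big = irreducible-bound F wf
          (counterexample-nfsIrreducible bounds (U , nonsingular⇒noOnce U ns , def , big)) def
      where U = uhit wf unsat hit
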